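{- Let $2\leq n\leq 7$. Every minimal complex generating $\mathsf{Mon}_n$ belongs to the $K_2$ family, the $K_5$ family, the $K_6$ family or the $K_7$ family.
   Context: For finite sets $A,I$, a language is a subset $L\subseteq A^I$. For finite sets $B,J$ and a function $f:B^J\to A^I$, the input window $\mathcal{W}_f(i)\subseteq J$ of $i\in I$ is the smallest $W\subseteq J$ such that for all $x,y\in B^J$ agreeing on $W$, $f(x)_i=f(y)_i$. The communication complex $K_f$ is the simplicial complex on vertex set $I$ whose simplices are the sets $S\subseteq I$ with $\bigcap_{i\in S}\mathcal{W}_f(i)\neq\emptyset$. A simplicial complex $K$ on $I$ generates $L$ if there exist finite sets $B,J$ and $f:B^J\to A^I$ with $f(B^J)=L$ and $K_f\subseteq K$; $K$ is minimal generating $L$ if it generates $L$ and no complex properly contained in $K$ generates $L$. $\mathsf{Mon}_n\subseteq\{0,1\}^n$ is the set of monotone (non-decreasing or non-increasing) binary strings of length $n$. Positions $I_n=\{0,\ldots,n-1\}$ are identified with $\mathbb{Z}/n\mathbb{Z}$; for $a,b\in\mathbb{Z}$, $[\![a,b]\!]=\{c\bmod n: a\leq c\leq b'\}$ where $b'\equiv b\pmod n$ and $a\leq b'<a+n$. $\langle S_0,\ldots,S_k\rangle$ denotes the complex whose maximal simplices are the $S_i$. Vertex insertion: for $i\in\{0,\ldots,n\}$ let $\rho^+_i:\{0,\ldots,n-1\}\to\{0,\ldots,n\}\setminus\{i\}$, $\rho^+_i(j)=j$ if $j<i$ and $j+1$ if $j\geq i$; for a complex $K$ on $I_n$, $\mathrm{ins}_i(K)$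 is the complex on $I_{n+1}$ generated by the sets $\rho^+_i(S)\cup\{i\}$ if $S$ contains $(i-1)\bmod n$ or $i\bmod n$, and $\rho^+_i(S)$ otherwise, for $S\in K$. The $K_2$ family: complexes $\langle I_n\setminus\{a\},I_n\setminus\{b\}\rangle$ with $a\neq b$. The $K_5$ family: for $n\geq5$, images under circular permutations $x\mapsto x+c\bmod n$ of $K^n_{i,j}=\langle[\![1,n-1]\!],[\![0,j-1]\!],[\![j+1,i-1]\!],[\![i+1,0]\!]\rangle$, $1<i<j<n-1$. $K_6=\langle[\![0,3]\!],[\![1,4]\!],[\![2,5]\!],[\![3,0]\!],[\![4,1]\!],[\![5,2]\!]\rangle$ on $I_6$ and $K_7=\langle[\![0,4]\!],[\![1,5]\!],[\![2,6]\!],[\![4,1]\!],[\![5,2]\!]\rangle$ on $I_7$; the $K_6$ (resp. $K_7$) family consists of complexes obtained from $K_6$ (resp. $K_7$) by finitely many vertex insertions and circular permutations. -}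

module Defs where

open import Data.Nat using (ℕ; zero; suc; _+_; _∸_; _≤ᵇ_; _<_; NonZero)
open import Data.Nat.DivMod using (_%_; _mod_)
open import Data.Fin using (Fin; toℕ; punchIn) renaming (_≤_ to _≤F_)
open import Data.Fin.Subset using (Subset; _∈_; _⊆_; ∁; ⁅_⁆)
open import Data.Bool using (Bool) renaming (_≤_ to _≤B_)
open import Data.Vec using (tabulate)
open import Data.List using (List; []; _∷_)
open import Data.List.Relation.Unary.Any using (Any)
open import Data.Product using (Σ; ∃; ∃-syntax; _×_)
open import Data.Sum using (_⊎_)
open import Relation.Binary.PropositionalEquality using (_≡_)
open import Relation.Nullary using (¬_)

Word : ℕ → Set
Word n = Fin n → Bool

Language : ℕ → Set₁
Language n = Word n → Set

NonDecreasing NonIncreasing : ∀ {n} → Word n → Set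
NonDecreasing w = ∀ i j → i ≤F j → w i ≤B w j
NonIncreasing w = ∀ i j → i ≤F j → w j ≤B w i

Mon : (n : ℕ) → Language n
Mon n w = NonDecreasing w ⊎ NonIncreasing w

Cx : ℕ → Set₁
Cx n = Subset n → Set

IsComplex : ∀ {n} → Cx n → Set
IsComplex K = ∀ S T → T ⊆ S → K S → K T

_⊆ₖ_ : ∀ {n} → Cx n → Cx n → Set
K ⊆ₖ K' = ∀ S → K S → K' S

_≈ₖ_ : ∀ {n} → Cx n → Cx n → Set
K ≈ₖ K' = K ⊆ₖ K' × K' ⊆ₖ K

⟨_⟩ : ∀ {n} → List (Subset n) → Cx n
⟨ Ss ⟩ T = Any (λ S → T ⊆ S) Ss

Determines : ∀ {b m n} → ((Fin m → Fin b) → Word n) → Fin n → Subset m → Set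
Determines f i W = ∀ x y → (∀ j → j ∈ W → x j ≡ y j) → f x i ≡ f y i

IsInputWindow : ∀ {b m n} → ((Fin m → Fin b) → Word n) → Fin n → Subset m → Set
IsInputWindow f i W = Determines f i W × (∀ W' → Determines f i W' → W ⊆ W')

-- K generates L: some f : B^J → A^I with B = Fin b, J = Fin m, image L, K_f ⊆ K.
-- W i is the input window of i; S ∈ K_f iff ⋂_{i∈S} W i ≠ ∅.
Generates : ∀ {n} → Language n → Cx n → Set
Generates {n} L K =
  ∃[ b ] ∃[ m ] Σ ((Fin m → Fin b) → Word n) λ f →
    (∀ x → L (f x)) ×
    (∀ w → L w → ∃[ x ] (∀ i → f x i ≡ w i)) ×
    Σ (Fin n → Subset m) λ W →
      (∀ i → IsInputWindow f i (W i)) ×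
      (∀ S → (∃[ j ] (∀ i → i ∈ S → j ∈ W i)) → K S)

MinimalGenerating : ∀ {n} → Language n → Cx n → Set₁
MinimalGenerating {n} L K =
  Generates L K ×
  (∀ (K' : Cx n) → IsComplex K' → K' ⊆ₖ K → Generates L K' → K ⊆ₖ K')

-- Circular intervals [[a,b]] on I_n (a, b natural numbers):
-- x ∈ [[a,b]] iff (x - a) mod n ≤ (b - a) mod n

⟦_,_⟧ : ∀ {n} .{{_ : NonZero n}} → ℕ → ℕ → Subset n
⟦_,_⟧ {n} a b = tabulate λ x →
  ((toℕ x + (n ∸ (a % n))) % n) ≤ᵇ ((b + (n ∸ (a % n))) % n)

_⊆img[_]_ : ∀ {n n'} → Subset n' → (Fin n → Fin n') → Subset n → Set
T ⊆img[ g ] S = ∀ y → y ∈ T → ∃[ x ] (x ∈ S × g x ≡ y)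

Rot : ∀ {n} .{{_ : NonZero n}} → ℕ → Cx n → Cx n
Rot {n} c K T = ∃[ S ] (K S × T ⊆img[ (λ x → (toℕ x + c) mod n) ] S)

Ins : ∀ {m} → Fin (suc (suc m)) → Cx (suc m) → Cx (suc (suc m))
Ins {m} i K T = ∃[ S ] (K S ×
  (∀ y → y ∈ T →
     (∃[ x ] (x ∈ S × punchIn i x ≡ y)) ⊎
     ((((toℕ i + m) mod suc m) ∈ S ⊎ (toℕ i mod suc m) ∈ S) × y ≡ i)))

K₂Family : ∀ {n} → Cx n → Set
K₂Family {n} K = ∃[ a ] ∃[ b ] (¬ a ≡ b × K ≈ₖ ⟨ ∁ ⁅ a ⁆ ∷ ∁ ⁅ b ⁆ ∷ [] ⟩)

K5 : (n : ℕ) .{{_ : NonZero n}} → ℕ → ℕ → Cx n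
K5 n i j = ⟨ ⟦ 1 , n ∸ 1 ⟧ ∷ ⟦ 0 , j ∸ 1 ⟧ ∷ ⟦ j + 1 , i ∸ 1 ⟧ ∷ ⟦ i + 1 , 0 ⟧ ∷ [] ⟩

K₅Family : ∀ {n} → Cx n → Set
K₅Family {zero} K = Data.Empty.⊥ where import Data.Empty
K₅Family {suc k} K = 5 Data.Nat.≤ suc k × ∃[ c ] ∃[ i ] ∃[ j ]
  (1 < i × i < j × suc j < suc k × K ≈ₖ Rot c (K5 (suc k) i j))
  where import Data.Nat

K6 : Cx 6
K6 = ⟨ ⟦ 0 , 3 ⟧ ∷ ⟦ 1 , 4 ⟧ ∷ ⟦ 2 , 5 ⟧ ∷ ⟦ 3 , 0 ⟧ ∷ ⟦ 4 , 1 ⟧ ∷ ⟦ 5 , 2 ⟧ ∷ [] ⟩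

K7 : Cx 7
K7 = ⟨ ⟦ 0 , 4 ⟧ ∷ ⟦ 1 , 5 ⟧ ∷ ⟦ 2 , 6 ⟧ ∷ ⟦ 4 , 1 ⟧ ∷ ⟦ 5 , 2 ⟧ ∷ [] ⟩

data Closure {n₀ : ℕ} (K₀ : Cx n₀) : (n : ℕ) → Cx n → Set₁ where
  base : ∀ {K} → K ≈ₖ K₀ → Closure K₀ n₀ K
  ins  : ∀ {m K K'} (i : Fin (suc (suc m))) →
         Closure K₀ (suc m) K → K' ≈ₖ Ins i K → Closure K₀ (suc (suc m)) K'
  rot  : ∀ {m K K'} (c : ℕ) →
         Closure K₀ (suc m) K → K' ≈ₖ Rot c K → Closure K₀ (suc m) K'

K₆Family : ∀ {n} → Cx n → Set₁
K₆Family {n} K = Closure K6 n K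

K₇Family : ∀ {n} → Cx n → Set₁
K₇Family {n} K = Closure K7 n K

module Submission where

-- Let K be minimal and let f generate Mon n with K_f ⊆ K. It suffices that K_f contains a member of
-- the families which generates Mon n: by minimality K is then equal to it.
--
-- Generation: Mon n is invariant under reversal and under rotation with negation of the letter that wraps
-- around, and doubling a vertex of a generating complex gives a generating complex. So explicit functions
-- for n = 2 (K₂), n = 5 (K₅) and n = 7 (K₇) are enough.
--
-- Non-generation: fix for each monotone word h a configuration of the inputs with image h, and consider
-- the configurations in which every input copies one of these. Two bits known from part of the inputs
-- force a third one, since w i ≡ w k implies w j ≡ w i for i ≤ j ≤ k; and the bit l then depends only on
-- those of these inputs which l reads. For certain lists of nonfaces, all choices lead to a
-- contradiction. Every complex contains a member of the families or omits, up to rotation and reversal,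
-- one of these lists.
--
-- The K₆ family contributes nothing: K₆ has no face with 5 elements, and the last list for n = 6
-- shows that such a complex does not generate Mon 6.

open import Defs
open import Data.Bool using (Bool; true; false; not; _∧_; _∨_; _xor_; if_then_else_; T) renaming (_≤_ to _≤B_;
  _≟_ to _≟B_; _≤?_ to _≤B?_)
open import Data.Bool.ListAction using (any)
open import Data.Bool.Properties using (¬-not; not-¬; ∨-zeroʳ; ∧-conicalˡ; ∧-conicalʳ)
  renaming (≤-antisym to ≤B-antisym; ≤-refl to ≤B-refl; ≤-minimum to ≤B-minimum; ≤-maximum to ≤B-maximum)
open import Data.Empty using (⊥)
open import Data.Fin as Fin using (Fin; zero; suc; toℕ; fromℕ; inject₁; opposite; pinch; punchIn; combine;
  quotient; remainder; _≤?_) renaming (_≤_ to _≤F_; _<_ to _<F_)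
open import Data.Fin.Patterns using (0F; 1F; 2F; 3F; 4F; 5F; 6F)
open import Data.Fin.Properties using (all?; any?; _≟_; toℕ-injective; toℕ<n; inject₁ℕ<; toℕ-fromℕ;
  toℕ-fromℕ<; toℕ-inject₁; ≤fromℕ; <⇒≢; opposite-prop; opposite-involutive; remQuot-combine; pinch-mono-≤;
  punchIn-mono-≤)
open import Data.Fin.Relation.Unary.Top using (view; ‵fromℕ; ‵inject₁; view-fromℕ; view-inject₁)
open import Data.Fin.Subset using (Subset; _∈_; _⊆_; _∪_; _∩_; ∁; ⁅_⁆; ⋂) renaming (⊤ to full)
open import Data.Fin.Subset.Properties using (_∈?_; _⊆?_; ∈⊤; ⊆-trans; x∈p∩q⁺; x∈p∩q⁻; x∈p∪q⁺; x∈p∪q⁻;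
  x∈∁p⇒x∉p; x∉p⇒x∈∁p; x∈⁅x⁆; x∈⁅y⁆⇒x≡y)
open import Data.List as List using (List; []; _∷_; _++_; map; concatMap; filter; cartesianProduct; upTo;
  allFin; length)
open import Data.List.Membership.Propositional using (find; lose) renaming (_∈_ to _∈ₗ_)
open import Data.List.Membership.Propositional.Properties using (∈-allFin; ∈-lookup)
open import Data.List.Properties using (map-id; map-∘)
open import Data.List.Relation.Unary.All as All using (All; []; _∷_)
import Data.List.Relation.Unary.All.Properties as AllP
open import Data.List.Relation.Unary.Any as Any using (Any; here; there)
import Data.List.Relation.Unary.Any.Properties as AnyP
open import Data.Maybe using (Maybe; just; nothing; _<∣>_)
open import Data.Nat as ℕ using (ℕ; zero; suc; _+_; _*_; _∸_; _≤_; _<_; z≤n; s≤s; _<ᵇ_; _≤ᵇ_; _≡ᵇ_)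
open import Data.Nat.DivMod using (_/_; _%_; _mod_; m<n⇒m%n≡m; n%n≡0; %-distribˡ-+; m%n<n; m%n%n≡m%n)
import Data.Nat.Properties as ℕₚ
open import Data.Nat.Properties using (<⇒≱; ∸-monoʳ-≤)
open import Data.Product using (∃; ∃-syntax; _×_; _,_; proj₁; proj₂)
open import Data.Sum as Sum using (_⊎_; inj₁; inj₂)
open import Data.Vec as Vec using (Vec; []; _∷_; lookup; tabulate; here; there)
open import Data.Vec.Properties using (lookup∘tabulate; tabulate-cong; []=⇒lookup; lookup⇒[]=)
open import Function using (_∘_; _$_; id)
open import Relation.Binary.PropositionalEquality
open import Relation.Nullary
open import Relation.Nullary.Decidable using (map′; _→-dec_; _×-dec_; _⊎-dec_; ¬?; isYes; True; toWitness)
open import Relation.Unary using (Decidable)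

-- Monotone words described by betweenness

private variable
  n m b k : ℕ

-- Monotonicity in a form that treats both directions alike and is insensitive to reversal and
-- negation. It is also the form in which the certificates use `Mon`.
Betweenness : Word n → Set
Betweenness w = ∀ {i j k} → i ≤F j → j ≤F k → w i ≡ w k → w j ≡ w i

mon⇒between : ∀ {w : Word n} → Mon n w → Betweenness w
mon⇒between {w = w} (inj₁ up) {i} {j} {k} i≤j j≤k e =
  ≤B-antisym (subst (λ a → w j ≤B a) (sym e) (up j k j≤k)) (up i j i≤j)
mon⇒between {w = w} (inj₂ down) {i} {j} {k} i≤j j≤k e =
  ≤B-antisym (down i j i≤j) (subst (λ a → a ≤B w j) (sym e) (down j k j≤k))

-- The letter at 0 fixes the direction: in a word that starts with `false`, a `true` followed by a
-- `false` would lie between two equal letters, the one at 0 and the later `false`.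
between⇒mon : ∀ {w : Word n} → Betweenness w → Mon n w
between⇒mon {zero} btw = inj₁ λ ()
between⇒mon {suc n} {w} btw with w zero in e
... | false = inj₁ up
  where
  up : NonDecreasing w
  up i j i≤j with w i in ei | w j in ej
  ... | false | c     = ≤B-minimum c
  ... | true  | true  = ≤B-refl
  ... | true  | false with () ← trans (sym ei) (trans (btw {zero} z≤n i≤j (trans e (sym ej))) e)
... | true = inj₂ down
  where
  down : NonIncreasing w
  down i j i≤j with w i in ei | w j in ej
  ... | true  | c     = ≤B-maximum c
  ... | false | false = ≤B-refl
  ... | false | true with () ← trans (sym ei) (trans (btw {zero} z≤n i≤j (trans e (sym ej))) e)

mon-resp-≗ : ∀ {v w : Word n} → (∀ i → v i ≡ w i) → Mon n v → Mon n w
mon-resp-≗ e v∈ = between⇒mon λ i≤j j≤k q →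
  trans (sym (e _)) (trans (mon⇒between v∈ i≤j j≤k (trans (e _) (trans q (sym (e _))))) (e _))

mon? : (w : Word n) → Dec (Mon n w)
mon? w = (all? λ i → all? λ j → (i Fin.≤? j) →-dec (w i ≤B? w j))
   ⊎-dec (all? λ i → all? λ j → (i Fin.≤? j) →-dec (w j ≤B? w i))

-- Decision by exhaustive search over vectors

∀vec? : ∀ {A : Set} → (∀ {P : A → Set} → Decidable P → Dec (∀ a → P a)) →
        ∀ {n} {P : Vec A n → Set} → Decidable P → Dec (∀ v → P v)
∀vec? ∀A? {zero}  P? = map′ (λ p → λ { [] → p }) (_$ []) (P? [])
∀vec? ∀A? {suc n} P? = map′ (λ h → λ { (a ∷ v) → h a v }) (λ h a v → h (a ∷ v))
  (∀A? λ a → ∀vec? ∀A? λ v → P? (a ∷ v))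

∃vec? : ∀ {b n} {P : Vec (Fin b) n → Set} → Decidable P → Dec (∃ P)
∃vec? {n = zero}  P? = map′ ([] ,_) (λ { ([] , p) → p }) (P? [])
∃vec? {n = suc n} P? = map′ (λ { (a , v , p) → (a ∷ v) , p }) (λ { (a ∷ v , p) → a , v , p })
  (any? λ a → ∃vec? λ v → P? (a ∷ v))

∀bool? : ∀ {P : Bool → Set} → Decidable P → Dec (∀ a → P a)
∀bool? P? = map′ (λ { (p , q) false → p ; (p , q) true → q }) (λ h → h false , h true) (P? false ×-dec P? true)

-- Generation and input windows

determines-mono : ∀ (f : (Fin m → Fin b) → Word n) i {V V'} → V ⊆ V' → Determines f i V → Determines f i V'
determines-mono f i V⊆V' det x y agree = det x y λ j j∈V → agree j (V⊆V' j∈V)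

-- The hybrid `z` copies `x` on `V` and `y` elsewhere. It also agrees with `y` on `V'`, because `x`
-- and `y` agree on the overlap; so the bit is the same at `x`, `z` and `y`.
determines-∩ : ∀ (f : (Fin m → Fin b) → Word n) i V V' →
               Determines f i V → Determines f i V' → Determines f i (V ∩ V')
determines-∩ {m} {b} f i V V' det det' x y agree = trans (det x z x≗z) (det' z y z≗y)
  where
  z : Fin m → Fin b
  z j with j ∈? V
  ... | yes _ = x j
  ... | no  _ = y j
  x≗z : ∀ j → j ∈ V → x j ≡ z j
  x≗z j j∈V with j ∈? V
  ... | yes _ = refl
  ... | no j∉V = contradiction j∈V j∉V
  z≗y : ∀ j → j ∈ V' → z j ≡ y j
  z≗y j j∈V' with j ∈? V
  ... | yes j∈V = agree j (x∈p∩q⁺ (j∈V , j∈V'))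
  ... | no _ = refl

-- The search runs over vectors. Replacing a function by its tabulation changes no bit because of
-- `Determines f i full`, which stands in for function extensionality.
determines? : ∀ (f : (Fin m → Fin b) → Word n) i → Determines f i full → ∀ V → Dec (Determines f i V)
determines? f i ext V = map′
  (λ h x y agree → trans (ext x _ λ j _ → sym (lookup∘tabulate x j))
     (trans (h (tabulate x) (tabulate y) λ j j∈V →
               trans (lookup∘tabulate x j) (trans (agree j j∈V) (sym (lookup∘tabulate y j))))
            (ext _ y λ j _ → lookup∘tabulate y j)))
  (λ det u v → det (lookup u) (lookup v))
  (∀vec? all? λ u → ∀vec? all? λ v →
     (all? λ j → (j ∈? V) →-dec (lookup u j ≟ lookup v j)) →-dec (f (lookup u) i ≟B f (lookup v) i))

determines⇒window : ∀ (f : (Fin m → Fin b) → Word n) i {V} →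
                    Determines f i V → ∃[ W ] (IsInputWindow f i W × W ⊆ V)
determines⇒window {m} f i {V} det =
  ⋂ (map without (allFin m)) , (determined (allFin m) , smallest) , smallest V det
  where
  ext : Determines f i full
  ext = determines-mono f i (λ _ → ∈⊤) det
  without : Fin m → Subset m
  without j with determines? f i ext (∁ ⁅ j ⁆)
  ... | yes _ = ∁ ⁅ j ⁆
  ... | no _  = full
  determined : ∀ js → Determines f i (⋂ (map without js))
  determined [] = ext
  determined (j ∷ js) = determines-∩ f i (without j) (⋂ (map without js)) det-without (determined js)
    where
    det-without : Determines f i (without j)
    det-without with determines? f i ext (∁ ⁅ j ⁆)
    ... | yes d = d
    ... | no _  = ext
  ⋂-without : ∀ {j js} → j ∈ₗ js → ⋂ (map without js) ⊆ without j
  ⋂-without {j} {_ ∷ js} (here refl) = proj₁ ∘ x∈p∩q⁻ (without j) (⋂ (map without js))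
  ⋂-without {j} {j' ∷ js} (there j∈) = ⋂-without j∈ ∘ proj₂ ∘ x∈p∩q⁻ (without j') (⋂ (map without js))
  smallest : ∀ W' → Determines f i W' → ⋂ (map without (allFin m)) ⊆ W'
  smallest W' det' {j} j∈ with j ∈? W'
  ... | yes j∈W' = j∈W'
  ... | no j∉W' with determines? f i ext (∁ ⁅ j ⁆) | ⋂-without {j} (∈-allFin j) j∈
  ...   | yes _ | j∈∁ = contradiction (x∈⁅x⁆ j) (x∈∁p⇒x∉p j∈∁)
  ...   | no ¬d | _ = contradiction (determines-mono f i W'⊆ det') ¬d
    where
    W'⊆ : W' ⊆ ∁ ⁅ j ⁆
    W'⊆ {j'} j'∈W' = x∉p⇒x∈∁p λ j'∈ → j∉W' (subst (_∈ W') (x∈⁅y⁆⇒x≡y j j'∈) j'∈W')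

-- For a construction it is enough to bound what each bit reads: the true windows lie inside the
-- `V i`, and passing to them only removes faces.
generates : ∀ {L : Language n} {K : Cx n} (f : (Fin m → Fin b) → Word n) → (∀ x → L (f x)) →
            (∀ w → L w → ∃[ x ] (∀ i → f x i ≡ w i)) →
            (V : Fin n → Subset m) → (∀ i → Determines f i (V i)) →
            (∀ S j → (∀ i → i ∈ S → j ∈ V i) → K S) → Generates L K
generates f f∈L onto V det faces =
  _ , _ , f , f∈L , onto , proj₁ ∘ W , proj₁ ∘ proj₂ ∘ W ,
  λ { S (j , h) → faces S j λ i i∈S → proj₂ (proj₂ (W i)) (h i i∈S) }
  where
  W : ∀ i → ∃[ U ] (IsInputWindow f i U × U ⊆ V i)
  W i = determines⇒window f i (det i)

generates-mono : ∀ {L : Language n} {K K' : Cx n} → K ⊆ₖ K' → Generates L K → Generates L K'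
generates-mono K⊆K' (_ , _ , f , f∈L , onto , W , isW , faces) =
  _ , _ , f , f∈L , onto , W , isW , λ S h → K⊆K' S (faces S h)

-- Facet lists, and transport of generation along symmetries

Generating : List (Subset n) → Set
Generating {n} Fs = Generates (Mon n) ⟨ Fs ⟩

preimage : (Fin n → Fin n) → Subset n → Subset n
preimage g S = tabulate (lookup S ∘ g)

∈-preimage⁺ : ∀ {g : Fin n → Fin n} {S x} → g x ∈ S → x ∈ preimage g S
∈-preimage⁺ {g = g} {S} {x} h = lookup⇒[]= x _ (trans (lookup∘tabulate _ x) ([]=⇒lookup h))

∈-preimage⁻ : ∀ {g : Fin n → Fin n} {S x} → x ∈ preimage g S → g x ∈ S
∈-preimage⁻ {g = g} {S} {x} h = lookup⇒[]= (g x) S (trans (sym (lookup∘tabulate _ x)) ([]=⇒lookup h))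

-- The sets `readers W j`, one for each input, span the communication complex: a set is a simplex
-- exactly when it lies in one of them.
readers : (Fin n → Subset m) → Fin m → Subset n
readers W j = tabulate λ i → lookup (W i) j

∈-readers⁺ : ∀ (W : Fin n → Subset m) j {i} → j ∈ W i → i ∈ readers W j
∈-readers⁺ W j {i} p = lookup⇒[]= i _ (trans (lookup∘tabulate (λ i → lookup (W i) j) i) ([]=⇒lookup p))

∈-readers⁻ : ∀ (W : Fin n → Subset m) j {i} → i ∈ readers W j → j ∈ W i
∈-readers⁻ W j {i} p = lookup⇒[]= j _ (trans (sym (lookup∘tabulate (λ i → lookup (W i) j) i)) ([]=⇒lookup p))

-- The new map permutes the old word by `ρ` and negates the letters marked by `s`. Each bit reads
-- the same inputs as the bit it comes from, so faces are only renamed. A word is reached by first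
-- undoing the symmetry, which is what `back` is for.
generates-transport : ∀ {K : Cx n} (σ ρ : Fin n → Fin n) (s : Fin n → Bool) →
  (∀ x → ρ (σ x) ≡ x) → (∀ y → σ (ρ y) ≡ y) →
  (∀ {w} → Mon n w → Mon n (λ y → s y xor w (ρ y))) →
  (∀ {w} → Mon n w → Mon n (λ x → s (σ x) xor w (σ x))) →
  Generates (Mon n) K → Generates (Mon n) (K ∘ preimage σ)
generates-transport {n} σ ρ s ρσ σρ forth back (_ , _ , f , f∈ , onto , W , isW , faces) =
  generates (λ x y → s y xor f x (ρ y)) (forth ∘ f∈) onto' (W ∘ ρ)
    (λ y x x' agree → cong (s y xor_) (proj₁ (isW (ρ y)) x x' agree))
    (λ S j h → faces _ (j , λ x x∈ → subst (λ z → j ∈ W z) (ρσ x) (h (σ x) (∈-preimage⁻ x∈))))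
  where
  cancel : ∀ a c → a xor (a xor c) ≡ c
  cancel false c = refl
  cancel true false = refl
  cancel true true = refl
  onto' : ∀ w → Mon n w → ∃[ x ] (∀ y → s y xor f x (ρ y) ≡ w y)
  onto' w w∈ with onto _ (back w∈)
  ... | x , e = x , λ y → trans (cong (s y xor_) (e (ρ y)))
                     (trans (cong (λ z → s y xor (s z xor w z)) (σρ y)) (cancel (s y) (w y)))

-- Rotations, reflection and duplication of a vertex

next prev : Fin (suc k) → Fin (suc k)
next i with view i
... | ‵fromℕ     = zero
... | ‵inject₁ j = suc j
prev zero    = fromℕ _
prev (suc i) = inject₁ i

next-fromℕ : ∀ k → next (fromℕ k) ≡ zero
next-fromℕ k rewrite view-fromℕ k = refl

next-inject₁ : (i : Fin k) → next (inject₁ i) ≡ suc i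
next-inject₁ i rewrite view-inject₁ i = refl

prev-next : (i : Fin (suc k)) → prev (next i) ≡ i
prev-next i with view i
... | ‵fromℕ     = refl
... | ‵inject₁ j = refl

next-prev : (i : Fin (suc k)) → next (prev i) ≡ i
next-prev zero    = next-fromℕ _
next-prev (suc i) = next-inject₁ i

first : Fin (suc k) → Bool
first zero    = true
first (suc _) = false

inject₁-mono : ∀ {i j : Fin k} → i ≤F j → inject₁ i ≤F inject₁ j
inject₁-mono {i = i} {j} i≤j = subst₂ _≤_ (sym (toℕ-inject₁ i)) (sym (toℕ-inject₁ j)) i≤j

last≰inject₁ : (j : Fin k) → ¬ fromℕ k ≤F inject₁ j
last≰inject₁ {k} j p = <⇒≱ (inject₁ℕ< j) (subst (λ x → x ≤ toℕ (inject₁ j)) (toℕ-fromℕ k) p)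

inject₁-cancel : ∀ {i j : Fin k} → inject₁ i ≤F inject₁ j → i ≤F j
inject₁-cancel {i = i} {j} i≤j = subst₂ _≤_ (toℕ-inject₁ i) (toℕ-inject₁ j) i≤j

-- Only triples starting at the new first letter, the negated old last one, need an argument. If the
-- letter at `l` equals it, it differs from the old last letter; then so does the letter at `j ≤ l`,
-- since otherwise `l` would lie between two equal letters, those at `j` and at the last position.
mon-turn : ∀ {w} → Mon (suc k) w → Mon (suc k) (λ y → first y xor w (prev y))
mon-turn {k} {w} w∈ = between⇒mon btw
  where
  btw : Betweenness (λ y → first y xor w (prev y))
  btw {zero} {zero} {_} _ _ _ = refl
  btw {zero} {suc j} {suc l} _ (s≤s j≤l) e = ¬-not λ wj≡last →
    not-¬ (trans (mon⇒between w∈ (inject₁-mono j≤l) (≤fromℕ (inject₁ l)) wj≡last) wj≡last) (sym e)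
  btw {suc i} {suc j} {suc l} (s≤s i≤j) (s≤s j≤l) e = mon⇒between w∈ (inject₁-mono i≤j) (inject₁-mono j≤l) e

-- As for `mon-turn`, but the exceptional triples end at the last position, where the negated letter
-- 0 has arrived.
mon-unturn : ∀ {w} → Mon (suc k) w → Mon (suc k) (λ x → first (next x) xor w (next x))
mon-unturn {k} {w} w∈ = between⇒mon btw
  where
  btw : Betweenness (λ x → first (next x) xor w (next x))
  btw {i} {j} {l} i≤j j≤l e with view i | view j | view l
  ... | _           | ‵fromℕ      | ‵fromℕ      = sym e
  ... | ‵inject₁ i' | ‵inject₁ j' | ‵fromℕ      =
    trans (¬-not λ wj≡w0 → not-¬ (mon⇒between w∈ z≤n (s≤s (inject₁-cancel i≤j)) (sym wj≡w0)) e) (sym e)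
  ... | ‵inject₁ i' | ‵inject₁ j' | ‵inject₁ l' =
    mon⇒between w∈ (s≤s (inject₁-cancel i≤j)) (s≤s (inject₁-cancel j≤l)) e
  ... | ‵fromℕ      | ‵inject₁ j' | _           = contradiction i≤j (last≰inject₁ j')
  ... | _           | ‵fromℕ      | ‵inject₁ l' = contradiction j≤l (last≰inject₁ l')

Refuted : ∀ {n} → List (Subset n) → Set₁
Refuted {n} Ns = ∀ (K : Cx n) → Generates (Mon n) K → ¬ All (λ S → ¬ K S) Ns

generates-turn : ∀ {K : Cx (suc k)} → Generates (Mon (suc k)) K → Generates (Mon (suc k)) (K ∘ preimage next)
generates-turn = generates-transport next prev first prev-next next-prev mon-turn mon-unturn

opposite-antitone : ∀ {i j : Fin n} → i ≤F j → opposite j ≤F opposite i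
opposite-antitone {n} {i} {j} i≤j =
  subst₂ _≤_ (sym (opposite-prop j)) (sym (opposite-prop i)) (∸-monoʳ-≤ n (s≤s i≤j))

mon-opposite : ∀ {w} → Mon n w → Mon n (w ∘ opposite)
mon-opposite (inj₁ up)   = inj₂ λ i j i≤j → up _ _ (opposite-antitone i≤j)
mon-opposite (inj₂ down) = inj₁ λ i j i≤j → down _ _ (opposite-antitone i≤j)

generates-opposite : ∀ {K : Cx n} → Generates (Mon n) K → Generates (Mon n) (K ∘ preimage opposite)
generates-opposite = generates-transport opposite opposite (λ _ → false)
  opposite-involutive opposite-involutive mon-opposite mon-opposite

-- If `K` omits the sets `g S`, then `K ∘ g` omits the sets `S`, and it generates whenever `K` does.
refuted-map : ∀ {g : Subset n → Subset n} → (∀ {K : Cx n} → Generates (Mon n) K → Generates (Mon n) (K ∘ g)) →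
              ∀ {Ns} → Refuted Ns → Refuted (map g Ns)
refuted-map gen ref K K-gen nonfaces = ref _ (gen K-gen) (AllP.map⁻ nonfaces)

turn : Subset (suc k) → Subset (suc k)
turn = preimage prev

generates-turns : ∀ {Fs : List (Subset (suc k))} → Generating Fs → Generating (map turn Fs)
generates-turns {k} gen = generates-mono sub (generates-turn gen)
  where
  sub : _ ⊆ₖ _
  sub T = AnyP.map⁺ ∘ Any.map λ T⊆S {y} y∈T →
    ∈-preimage⁺ {g = prev} (T⊆S (∈-preimage⁺ {g = next} (subst (_∈ T) (sym (next-prev y)) y∈T)))

-- This is `Ins` at position 1: the new vertex sits between the old vertices 0 and 1 and joins every
-- facet that contains one of them.
double : Subset (2 + k) → Subset (3 + k)
double (s ∷ t ∷ S) = s ∷ (s ∨ t) ∷ t ∷ S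

pick : Bool → Bool → Bool → Bool
pick a c d = if does (a ≟B c) then a else d

pick-either : ∀ a c d → pick a c d ≡ a ⊎ pick a c d ≡ c
pick-either false false _     = inj₁ refl
pick-either false true  false = inj₁ refl
pick-either false true  true  = inj₂ refl
pick-either true  false false = inj₂ refl
pick-either true  false true  = inj₁ refl
pick-either true  true  _     = inj₁ refl

mon-∘ : ∀ {w : Word n} (g : Fin m → Fin n) → (∀ {i j} → i ≤F j → g i ≤F g j) → Mon n w → Mon m (w ∘ g)
mon-∘ g g-mono (inj₁ up)   = inj₁ λ i j i≤j → up _ _ (g-mono i≤j)
mon-∘ g g-mono (inj₂ down) = inj₂ λ i j i≤j → down _ _ (g-mono i≤j)

double-member : ∀ {s t} {R : Subset k} {S : Subset (3 + k)} →
  (zero ∈ S → zero ∈ s ∷ t ∷ R) → (suc zero ∈ S → zero ∈ s ∷ t ∷ R ⊎ suc zero ∈ s ∷ t ∷ R) →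
  (∀ i → suc (suc i) ∈ S → suc i ∈ s ∷ t ∷ R) → S ⊆ double (s ∷ t ∷ R)
double-member h₀ h₁ h₂ {zero} p with h₀ p
... | here = here
double-member {s = s} h₀ h₁ h₂ {suc zero} p with h₁ p
... | inj₁ here = there here
... | inj₂ (there here) = there (lookup⇒[]= zero _ (∨-zeroʳ s))
double-member h₀ h₁ h₂ {suc (suc i)} p with h₂ i p
... | there q = there (there q)

-- Every input carries two letters. The left ones yield a word of length 2 + k; where its letters 0
-- and 1 differ, the new letter between them is free, and it copies letter 0 of the word of the right ones.
generates-double : ∀ {Fs : List (Subset (2 + k))} → Generating Fs → Generating (map double Fs)
generates-double {k} {Fs} (b , m , f , f∈ , onto , W , isW , faces) = generates f' f'∈ onto' W' det' faces'
  where
  left right : (Fin m → Fin (b * b)) → Fin m → Fin b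
  left  x j = quotient b (x j)
  right x j = remainder {b} b (x j)
  f' : (Fin m → Fin (b * b)) → Word (3 + k)
  f' x zero          = f (left x) zero
  f' x (suc zero)    = pick (f (left x) zero) (f (left x) (suc zero)) (f (right x) zero)
  f' x (suc (suc i)) = f (left x) (suc i)
  W' : Fin (3 + k) → Subset m
  W' zero          = W zero
  W' (suc zero)    = W zero ∪ W (suc zero)
  W' (suc (suc i)) = W (suc i)
  f'∈ : ∀ x → Mon (3 + k) (f' x)
  -- The middle letter equals one of its neighbours, so the new word is the old one with letter 0 or
  -- letter 1 repeated, that is, composed with `pinch`.
  f'∈ x with pick-either (f (left x) zero) (f (left x) (suc zero)) (f (right x) zero)
  ... | inj₁ e = mon-resp-≗ (λ { zero → refl ; (suc zero) → sym e ; (suc (suc i)) → refl })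
                   (mon-∘ (pinch zero) (pinch-mono-≤ zero) (f∈ (left x)))
  ... | inj₂ e = mon-resp-≗ (λ { zero → refl ; (suc zero) → sym e ; (suc (suc i)) → refl })
                   (mon-∘ (pinch (suc zero)) (pinch-mono-≤ (suc zero)) (f∈ (left x)))
  onto' : ∀ w → Mon (3 + k) w → ∃[ x ] (∀ i → f' x i ≡ w i)
  -- The left letters realise `w` without its letter 1, the right ones a constant word holding this
  -- letter.
  onto' w w∈ with onto (w ∘ punchIn (suc zero)) (mon-∘ (punchIn (suc zero)) (punchIn-mono-≤ (suc zero) _ _) w∈)
                | onto (λ _ → w (suc zero)) (inj₁ λ _ _ _ → ≤B-refl)
  ... | p , fp | q , fq = x , λ { zero → left-x zero ; (suc zero) → middle ; (suc (suc i)) → left-x (suc i) }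
    where
    x : Fin m → Fin (b * b)
    x j = combine (p j) (q j)
    left-x : ∀ i → f (left x) i ≡ w (punchIn (suc zero) i)
    left-x i = trans (proj₁ (isW i) (left x) p λ j _ → cong proj₁ (remQuot-combine (p j) (q j))) (fp i)
    right-x : f (right x) zero ≡ w (suc zero)
    right-x = trans (proj₁ (isW zero) (right x) q λ j _ → cong proj₂ (remQuot-combine (p j) (q j))) (fq zero)
    picked : pick (w zero) (w (suc (suc zero))) (w (suc zero)) ≡ w (suc zero)
    picked with w zero ≟B w (suc (suc zero))
    ... | yes e = sym (mon⇒between w∈ z≤n (s≤s z≤n) e)
    ... | no _  = refl
    middle : f' x (suc zero) ≡ w (suc zero)
    middle rewrite left-x zero | left-x (suc zero) | right-x = picked
  det' : ∀ i → Determines f' i (W' i)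
  det' zero x y agree = proj₁ (isW zero) _ _ λ j j∈ → cong (quotient b) (agree j j∈)
  det' (suc zero) x y agree
    rewrite proj₁ (isW zero) (left x) (left y)
              (λ j j∈ → cong (quotient b) (agree j (x∈p∪q⁺ (inj₁ j∈))))
          | proj₁ (isW (suc zero)) (left x) (left y)
              (λ j j∈ → cong (quotient b) (agree j (x∈p∪q⁺ (inj₂ j∈))))
          | proj₁ (isW zero) (right x) (right y)
              (λ j j∈ → cong (remainder {b} b) (agree j (x∈p∪q⁺ (inj₁ j∈)))) = refl
  det' (suc (suc i)) x y agree = proj₁ (isW (suc i)) _ _ λ j j∈ → cong (quotient b) (agree j j∈)
  faces' : ∀ S j → (∀ i → i ∈ S → j ∈ W' i) → ⟨ map double Fs ⟩ S
  faces' S j h = AnyP.map⁺ (Any.map (λ {R} → covered R) (faces (readers W j) (j , λ i → ∈-readers⁻ W j)))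
    where
    covered : ∀ R → readers W j ⊆ R → S ⊆ double R
    covered (s ∷ t ∷ R) seen⊆R = double-member
      (λ p → seen⊆R (∈-readers⁺ W j (h _ p)))
      (λ p → Sum.map (seen⊆R ∘ ∈-readers⁺ W j) (seen⊆R ∘ ∈-readers⁺ W j) (x∈p∪q⁻ _ _ (h _ p)))
      (λ i p → seen⊆R (∈-readers⁺ W j (h _ p)))

-- Certificates that a complex does not generate Mon n

-- For h < 2n these are all the monotone words; h ↦ h + 1 is a rotation with negation.
word : ∀ n → ℕ → Word n
word n h i = if h ≤ᵇ n then toℕ i <ᵇ h else not (n + toℕ i <ᵇ h)

<ᵇ-antitone : ∀ {a c} h → a ≤ c → (c <ᵇ h) ≤B (a <ᵇ h)
<ᵇ-antitone {a} {c} h a≤c with c <ᵇ h in eq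
... | false = ≤B-minimum _
... | true with a <ᵇ h | ℕₚ.<⇒<ᵇ (ℕₚ.≤-<-trans a≤c (ℕₚ.<ᵇ⇒< c h (subst T (sym eq) _)))
...   | true | _ = ≤B-refl

not-antitone : ∀ {a c} → a ≤B c → not c ≤B not a
not-antitone _≤B_.f≤t = _≤B_.f≤t
not-antitone _≤B_.b≤b = _≤B_.b≤b

mon-word : ∀ n h → Mon n (word n h)
mon-word n h with h ≤ᵇ n
... | true  = inj₂ λ i j i≤j → <ᵇ-antitone h i≤j
... | false = inj₁ λ i j i≤j → not-antitone (<ᵇ-antitone h (ℕₚ.+-monoʳ-≤ n i≤j))

-- A fact asserts `bit` at position `at` for every assignment of letters to facets that matches
-- `pins`; `nothing` leaves a facet free. An index below `k` stands for all inputs merged into one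
-- facet, which carry a common letter.
record Fact (n k : ℕ) : Set where
  constructor fact
  field
    at   : Fin n
    bit  : Bool
    pins : Vec (Maybe ℕ) k

nth : ∀ {A : Set} → List A → ℕ → Maybe A
nth []       _       = nothing
nth (a ∷ as) zero    = just a
nth (a ∷ as) (suc p) = nth as p

Consistent : Maybe ℕ → Maybe ℕ → Set
Consistent σ τ = ∀ {a c} → σ ≡ just a → τ ≡ just c → a ≡ c

consistent? : ∀ σ τ → Dec (Consistent σ τ)
consistent? nothing  _        = yes λ ()
consistent? (just a) nothing  = yes λ _ ()
consistent? (just a) (just c) = map′ (λ { refl refl refl → refl }) (λ h → h refl refl) (a ℕ.≟ c)

module _ (Fs : Vec (Subset n) k) where

  -- Bit `l` reads only the facets that contain `l`, so the other pins can be forgotten, which makes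
  -- the fact compatible with more facts. No other operation of the checker looks at the facets.
  restrict : Fin n → (Fin k → Maybe ℕ) → Vec (Maybe ℕ) k
  restrict l σ = tabulate λ t → if lookup (lookup Fs t) l then σ t else nothing

  between? : (i l j : Fin n) → Dec (i ≤F l × l ≤F j ⊎ j ≤F l × l ≤F i)
  between? i l j = (i ≤? l ×-dec l ≤? j) ⊎-dec (j ≤? l ×-dec l ≤? i)

  -- Either `l` lies between equal bits at `i` and `j`, or the bits at `i` and `j` differ and `i`
  -- lies between `l` and `j`. In the second case the bit at `l` cannot equal the one at `j`, or `i`
  -- would break betweenness. In both cases it is `a`, the bit of the first fact.
  Forced : Fin n → Fact n k → Fact n k → Set
  Forced l (fact i a σ) (fact j c τ) =
    (∀ t → Consistent (lookup σ t) (lookup τ t)) ×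
    ((i ≤F l × l ≤F j ⊎ j ≤F l × l ≤F i) × a ≡ c ⊎ (l ≤F i × i ≤F j ⊎ j ≤F i × i ≤F l) × ¬ a ≡ c)

  forced? : ∀ l A B → Dec (Forced l A B)
  forced? l (fact i a σ) (fact j c τ) =
    (all? λ t → consistent? (lookup σ t) (lookup τ t)) ×-dec
    ((between? i l j ×-dec a ≟B c) ⊎-dec (between? l i j ×-dec ¬? (a ≟B c)))

  conclusion : Fin n → Fact n k → Fact n k → Fact n k
  conclusion l (fact i a σ) (fact j c τ) = fact l a (restrict l λ t → lookup σ t <∣> lookup τ t)

  Clash : Fact n k → Fact n k → Set
  Clash (fact i a σ) (fact j c τ) = i ≡ j × ¬ a ≡ c × (∀ t → Consistent (lookup σ t) (lookup τ t))

  clash? : ∀ A B → Dec (Clash A B)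
  clash? (fact i a σ) (fact j c τ) =
    i ≟ j ×-dec ¬? (a ≟B c) ×-dec all? λ t → consistent? (lookup σ t) (lookup τ t)

  module Sound (g : (Fin k → ℕ) → Word n) (g∈ : ∀ u → Mon n (g u))
               (local : ∀ i u v → (∀ t → i ∈ lookup Fs t → u t ≡ v t) → g u i ≡ g v i) where

    _⊨_ : (Fin k → ℕ) → Vec (Maybe ℕ) k → Set
    u ⊨ σ = ∀ t {a} → lookup σ t ≡ just a → u t ≡ a

    record Valid (A : Fact n k) : Set where
      constructor valid
      field holds : ∀ u → u ⊨ Fact.pins A → g u (Fact.at A) ≡ Fact.bit A
    open Valid

    restrict-just : ∀ l σ t {a} → l ∈ lookup Fs t → σ t ≡ just a → lookup (restrict l σ) t ≡ just a
    restrict-just l σ t l∈ e =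
      trans (lookup∘tabulate _ t) (trans (cong (if_then σ t else nothing) ([]=⇒lookup l∈)) e)

    override : (Fin k → Maybe ℕ) → (Fin k → ℕ) → Fin k → ℕ
    override σ u t with σ t
    ... | just a  = a
    ... | nothing = u t

    override-just : ∀ σ u t {a} → σ t ≡ just a → override σ u t ≡ a
    override-just σ u t e rewrite e = refl

    override-local : ∀ l σ u → u ⊨ restrict l σ → g u l ≡ g (override σ u) l
    override-local l σ u u⊨ = local l u _ agree
      where
      agree : ∀ t → l ∈ lookup Fs t → u t ≡ override σ u t
      agree t l∈ with σ t in e
      ... | just a  = u⊨ t (restrict-just l σ t l∈ e)
      ... | nothing = refl

    ⊨-override : ∀ (σ τ : Vec (Maybe ℕ) k) u → (∀ t → Consistent (lookup σ t) (lookup τ t)) →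
      let v = override (λ t → lookup σ t <∣> lookup τ t) u in v ⊨ σ × v ⊨ τ
    ⊨-override σ τ u cons = first' , second
      where
      first' : override (λ t → lookup σ t <∣> lookup τ t) u ⊨ σ
      first' t e = override-just (λ t → lookup σ t <∣> lookup τ t) u t (cong (_<∣> lookup τ t) e)
      second : override (λ t → lookup σ t <∣> lookup τ t) u ⊨ τ
      second t e with lookup σ t | cons t
      ... | just a  | c = c refl e
      ... | nothing | _ rewrite e = refl

    -- An assignment that matches the restricted pins need not match the premises. Overriding it by
    -- the pins of both makes them apply and changes nothing on the facets containing `l`, whose
    -- pins were kept; so the bit at `l` is the same.
    conclusion-valid : ∀ {l A B} → Forced l A B → Valid A → Valid B → Valid (conclusion l A B)
    conclusion-valid {l} {fact i a σ} {fact j c τ} (cons , how) valid-A valid-B = valid λ u u⊨ →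
      let v⊨σ , v⊨τ = ⊨-override σ τ u cons in
      trans (override-local l (λ t → lookup σ t <∣> lookup τ t) u u⊨) (by _ (holds valid-A _ v⊨σ) (holds valid-B _ v⊨τ) how)
      where
      by : ∀ v → g v i ≡ a → g v j ≡ c →
           (i ≤F l × l ≤F j ⊎ j ≤F l × l ≤F i) × a ≡ c ⊎ (l ≤F i × i ≤F j ⊎ j ≤F i × i ≤F l) × ¬ a ≡ c →
           g v l ≡ a
      by v vi vj (inj₁ (inj₁ (i≤l , l≤j) , a≡c)) =
        trans (mon⇒between (g∈ v) i≤l l≤j (trans vi (trans a≡c (sym vj)))) vi
      by v vi vj (inj₁ (inj₂ (j≤l , l≤i) , a≡c)) =
        trans (mon⇒between (g∈ v) j≤l l≤i (trans vj (trans (sym a≡c) (sym vi)))) (trans vj (sym a≡c))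
      by v vi vj (inj₂ (btw , a≢c)) with g v l ≟B a
      ... | yes gvl≡a = gvl≡a
      ... | no gvl≢a = contradiction (a≡c btw) a≢c
        where
        l≡j : g v l ≡ g v j
        l≡j = trans (¬-not gvl≢a) (sym (trans vj (¬-not (a≢c ∘ sym))))
        a≡c : (l ≤F i × i ≤F j ⊎ j ≤F i × i ≤F l) → a ≡ c
        a≡c (inj₁ (l≤i , i≤j)) = trans (sym vi) (trans (mon⇒between (g∈ v) l≤i i≤j l≡j) (trans l≡j vj))
        a≡c (inj₂ (j≤i , i≤l)) = trans (sym vi) (trans (mon⇒between (g∈ v) j≤i i≤l (sym l≡j)) vj)

    clash-absurd : ∀ {A B} → Clash A B → Valid A → Valid B → ⊥
    clash-absurd {fact i a σ} {fact j c τ} (refl , a≢c , cons) valid-A valid-B =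
      a≢c (trans (sym (holds valid-A v (proj₁ v⊨))) (holds valid-B v (proj₂ v⊨)))
      where
      v : Fin k → ℕ
      -- Facets pinned by neither fact get the letter 0; any letter would do.
      v = override (λ t → lookup σ t <∣> lookup τ t) (λ _ → 0)
      v⊨ : v ⊨ σ × v ⊨ τ
      v⊨ = ⊨-override σ τ (λ _ → 0) cons

    pinned-valid : ∀ i u {a} → g u i ≡ a → Valid (fact i a (restrict i (just ∘ u)))
    pinned-valid i u e = valid λ v v⊨ →
      trans (local i v u λ t i∈ → v⊨ t (restrict-just i (just ∘ u) t i∈ refl)) e

-- The numbers p and q count facts backwards from the most recent one. The two branches of a split
-- assume that the bit at i is false and true, when every input t carries the t-th letter of the list.
data Step : Set where
  letter : (h i : ℕ) → Step
  infer  : (l p q : ℕ) → Step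

infixr 5 _⨾_
data Refutation : Set where
  _⨾_   : Step → Refutation → Refutation
  split : (i : ℕ) → List ℕ → Refutation → Refutation → Refutation
  clash : (p q : ℕ) → Refutation

letters : List ℕ → Fin k → ℕ
letters us t with nth us (toℕ t)
... | just h  = h
... | nothing = 0

-- `mod` only turns the numerals of a certificate into positions, and an index outside `Γ` makes the
-- check fail. Soundness can thus be proved for arbitrary certificates.
refutes : ∀ {n k} → Vec (Subset (suc n)) k → List (Fact (suc n) k) → Refutation → Bool
refutes {n} Fs Γ (letter h i ⨾ r) =
  refutes Fs (fact (i mod suc n) (word (suc n) h (i mod suc n)) (restrict Fs (i mod suc n) λ _ → just h) ∷ Γ) r
refutes {n} Fs Γ (infer l p q ⨾ r) with nth Γ p | nth Γ q
... | just A | just B =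
  isYes (forced? Fs (l mod suc n) A B) ∧ refutes Fs (conclusion Fs (l mod suc n) A B ∷ Γ) r
... | _ | _ = false
refutes {n} Fs Γ (split i us r s) =
  refutes Fs (fact (i mod suc n) false pins ∷ Γ) r ∧ refutes Fs (fact (i mod suc n) true pins ∷ Γ) s
  where
  pins = restrict Fs (i mod suc n) (just ∘ letters us)
refutes Fs Γ (clash p q) with nth Γ p | nth Γ q
... | just A | just B = isYes (clash? Fs A B)
... | _ | _ = false

module _ {n k} (Fs : Vec (Subset (suc n)) k)
         (g : (Fin k → ℕ) → Word (suc n)) (g∈ : ∀ u → Mon (suc n) (g u))
         (local : ∀ i u v → (∀ t → i ∈ lookup Fs t → u t ≡ v t) → g u i ≡ g v i)
         (idempotent : ∀ h i → g (λ _ → h) i ≡ word (suc n) h i) where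

  open Sound Fs g g∈ local

  nth-all : ∀ {Γ p A} → All Valid Γ → nth Γ p ≡ just A → Valid A
  nth-all {p = zero}  (v ∷ _)  refl = v
  nth-all {p = suc p} (_ ∷ vs) e    = nth-all {p = p} vs e

  witness : ∀ {P : Set} (P? : Dec P) → isYes P? ≡ true → P
  witness (yes p) _ = p

  refutes-sound : ∀ {Γ} r → refutes Fs Γ r ≡ true → All Valid Γ → ⊥
  refutes-sound (letter h i ⨾ r) ok vs =
    refutes-sound r ok (pinned-valid _ (λ _ → h) (idempotent h _) ∷ vs)
  refutes-sound {Γ} (infer l p q ⨾ r) ok vs with nth Γ p in ep | nth Γ q in eq
  ... | just A | just B = refutes-sound r (∧-conicalʳ _ _ ok)
    (conclusion-valid (witness (forced? Fs _ A B) (∧-conicalˡ _ _ ok))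
       (nth-all {p = p} vs ep) (nth-all {p = q} vs eq) ∷ vs)
  -- The bit that `g` actually produces under this assignment selects the branch whose assumption is
  -- valid.
  refutes-sound (split i us r s) ok vs with g (letters us) (i mod suc n) in e
  ... | false = refutes-sound r (∧-conicalˡ _ _ ok) (pinned-valid _ (letters us) e ∷ vs)
  ... | true  = refutes-sound s (∧-conicalʳ (refutes Fs (_ ∷ _) r) _ ok) (pinned-valid _ (letters us) e ∷ vs)
  refutes-sound {Γ} (clash p q) ok vs with nth Γ p in ep | nth Γ q in eq
  ... | just A | just B =
    clash-absurd (witness (clash? Fs A B) ok) (nth-all {p = p} vs ep) (nth-all {p = q} vs eq)

-- From checked certificates to refuted lists of nonfaces

Covers : List (Subset n) → Vec (Subset n) k → Set
Covers Ns Fs = ∀ T → Any (_⊆ T) Ns ⊎ ∃[ t ] T ⊆ lookup Fs t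

covers? : ∀ (Ns : List (Subset n)) (Fs : Vec (Subset n) k) → Dec (Covers Ns Fs)
covers? Ns Fs = ∀vec? ∀bool? λ T → Any.any? (_⊆? T) Ns ⊎-dec any? λ t → T ⊆? lookup Fs t

-- The letter h of an input stands for its value in a fixed configuration with image word n h, and the
-- inputs are merged according to facets of which they are read by a subset.
refutation⇒refuted : ∀ {n k} {Ns : List (Subset (suc n))} (Fs : Vec (Subset (suc n)) k) →
  Covers Ns Fs → ∀ r → refutes Fs [] r ≡ true → Refuted Ns
refutation⇒refuted {n} {k} {Ns} Fs covers r ok K (b , m , f , f∈ , onto , W , isW , faces) nonfaces =
  refutes-sound Fs g (λ u → f∈ _) local idempotent r ok []
  where
  input : ℕ → Fin m → Fin b
  input h = proj₁ (onto (word (suc n) h) (mon-word (suc n) h))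
  -- All sets of readers of `j` are faces of `K`, so none of them is among the nonfaces; hence the
  -- readers lie in some facet, and `j` is assigned to it.
  home : ∀ j → ∃[ t ] readers W j ⊆ lookup Fs t
  home j with covers (readers W j)
  ... | inj₂ t = t
  ... | inj₁ N⊆ = let ¬KN , N⊆T = All.lookupAny nonfaces N⊆ in
    contradiction (faces _ (j , λ i i∈ → ∈-readers⁻ W j (N⊆T i∈))) ¬KN
  g : (Fin k → ℕ) → Word (suc n)
  g u = f λ j → input (u (proj₁ (home j))) j
  local : ∀ i u v → (∀ t → i ∈ lookup Fs t → u t ≡ v t) → g u i ≡ g v i
  local i u v agree = proj₁ (isW i) _ _ λ j j∈ →
    cong (λ h → input h j) (agree (proj₁ (home j)) (proj₂ (home j) (∈-readers⁺ W j j∈)))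
  -- When all facets carry `h`, merging has no effect and the configuration is the fixed one with
  -- image `word (suc n) h`.
  idempotent : ∀ h i → g (λ _ → h) i ≡ word (suc n) h i
  idempotent h i = proj₂ (onto (word (suc n) h) (mon-word (suc n) h)) i

-- Generation by K₂, K₅ and K₇

module Table {b n} (Fs : List (Subset n)) (G : Fin n → Vec (Fin (suc b)) (length Fs) → Bool) where

  -- There is one input per facet. Letters of facets that do not contain `i` become `zero` before
  -- the table is consulted, so the table reads only what bit `i` may read, and only the image is
  -- left to check.
  mask : Fin n → (Fin (length Fs) → Fin (suc b)) → Vec (Fin (suc b)) (length Fs)
  mask i x = tabulate λ j → if lookup (List.lookup Fs j) i then x j else zero

  f : (Fin (length Fs) → Fin (suc b)) → Word n
  f x i = G i (mask i x)

  Sound Onto : Set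
  Sound = ∀ v → Mon n (f (lookup v))
  Onto  = ∀ w → Mon n (lookup w) → ∃[ v ] (∀ i → f (lookup v) i ≡ lookup w i)

  sound? : Dec Sound
  sound? = ∀vec? all? λ v → mon? (f (lookup v))

  onto? : Dec Onto
  onto? = ∀vec? ∀bool? λ w → mon? (lookup w) →-dec ∃vec? λ v → all? λ i → f (lookup v) i ≟B lookup w i

  table-generates : {_ : True sound?} {_ : True onto?} → Generates (Mon n) ⟨ Fs ⟩
  table-generates {sound!} {onto!} = generates f
    (λ x → mon-resp-≗ (f-tabulate x) (sound (tabulate x)))
    (λ w w∈ → let v , e = onto (tabulate w) (mon-resp-≗ (λ i → sym (lookup∘tabulate w i)) w∈)
              in lookup v , λ i → trans (e i) (lookup∘tabulate w i))
    (readers (List.lookup Fs))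
    (λ i x y agree → cong (G i) (tabulate-cong (masked i x y agree)))
    (λ S j h → lose (∈-lookup {xs = Fs} j) λ {i} i∈S → ∈-readers⁻ (List.lookup Fs) i (h i i∈S))
    where
    sound = toWitness sound!
    onto  = toWitness onto!
    f-tabulate : ∀ x i → f (lookup (tabulate x)) i ≡ f x i
    f-tabulate x i = cong (G i) (tabulate-cong λ j →
      cong (if lookup (List.lookup Fs j) i then_else zero) (lookup∘tabulate x j))
    masked : ∀ i x y → (∀ j → j ∈ readers (List.lookup Fs) i → x j ≡ y j) → ∀ j →
      (if lookup (List.lookup Fs j) i then x j else zero) ≡ (if lookup (List.lookup Fs j) i then y j else zero)
    masked i x y agree j with lookup (List.lookup Fs j) i in e
    ... | false = refl
    ... | true  = agree j (∈-readers⁺ (List.lookup Fs) i (lookup⇒[]= i _ e))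

k₂ : Fin n → Fin n → List (Subset n)
k₂ a c = ∁ ⁅ a ⁆ ∷ ∁ ⁅ c ⁆ ∷ []

k₅ : ∀ n .{{_ : ℕ.NonZero n}} → ℕ → ℕ → List (Subset n)
k₅ n i j = ⟦ 1 , n ∸ 1 ⟧ ∷ ⟦ 0 , j ∸ 1 ⟧ ∷ ⟦ j + 1 , i ∸ 1 ⟧ ∷ ⟦ i + 1 , 0 ⟧ ∷ []

k₇ : List (Subset 7)
k₇ = ⟦ 0 , 4 ⟧ ∷ ⟦ 1 , 5 ⟧ ∷ ⟦ 2 , 6 ⟧ ∷ ⟦ 4 , 1 ⟧ ∷ ⟦ 5 , 2 ⟧ ∷ []

on : Fin (suc b) → Bool
on zero    = false
on (suc _) = true

-- The tables were found by a SAT solver; the t-th entry of the vector is the input read by the t-th facet.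
table₂ : Fin 2 → Vec (Fin 2) 2 → Bool
table₂ 0F (_ ∷ y ∷ []) = on y
table₂ 1F (x ∷ _ ∷ []) = on x

table₅ : Fin 5 → Vec (Fin 3) 4 → Bool
table₅ i (a ∷ x ∷ y ∷ z ∷ []) = entry i a (on x) (on y) (on z)
  where
  entry : Fin 5 → Fin 3 → Bool → Bool → Bool → Bool
  entry 0F _  x y z = if y then x ∧ z else x ∨ z
  entry 1F 0F x y z = x ∧ not y
  entry 1F 1F x y z = x ∨ not y
  entry 1F 2F x y z = x
  entry 2F 0F x y z = false
  entry 2F 1F x y z = true
  entry 2F 2F x y z = x
  entry 3F 0F x y z = false
  entry 3F 1F x y z = true
  entry 3F 2F x y z = not z
  entry 4F 0F x y z = y ∧ not z
  entry 4F 1F x y z = y ∨ not z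
  entry 4F 2F x y z = not z

table₇ : Fin 7 → Vec (Fin 2) 5 → Bool
table₇ i (p ∷ q ∷ r ∷ s ∷ t ∷ []) = entry i (on p) (on q) (on r) (on s) (on t)
  where
  entry : Fin 7 → Bool → Bool → Bool → Bool → Bool → Bool
  entry 0F p q r s t = if p then not (s ∧ t) else not s ∧ t
  entry 1F p q r s t = if p then q ∨ not (s ∧ t) else q ∧ not s ∧ t
  entry 2F p q r s t = if p then q ∨ r ∨ not t else q ∧ r ∧ t
  entry 3F p q r s t = if p then q ∨ r else q ∧ r
  entry 4F p q r s t = if p then r ∨ q ∧ s else r ∧ (q ∨ s)
  entry 5F p q r s t = if q then r ∨ s ∧ t else r ∧ (s ∨ not t)
  entry 6F p q r s t = if r then s ∨ not t else s ∧ t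

generates-k₂ : Generates (Mon 2) ⟨ k₂ zero (suc zero) ⟩
generates-k₂ = Table.table-generates (k₂ zero (suc zero)) table₂

generates-k₅ : Generates (Mon 5) ⟨ k₅ 5 2 3 ⟩
generates-k₅ = Table.table-generates (k₅ 5 2 3) table₅

generates-k₇ : Generates (Mon 7) ⟨ k₇ ⟩
generates-k₇ = Table.table-generates k₇ table₇

-- The families of generating complexes

turnBy : ℕ → Subset (suc k) → Subset (suc k)
turnBy zero    S = S
turnBy (suc c) S = turn (turnBy c S)

generates-turnBy : ∀ c {Fs : List (Subset (suc k))} → Generating Fs → Generating (map (turnBy c) Fs)
generates-turnBy zero {Fs} gen = subst Generating (sym (map-id Fs)) gen
generates-turnBy (suc c) {Fs} gen = subst Generating (sym (map-∘ Fs)) (generates-turns (generates-turnBy c gen))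

-- The vertex insertion ins_i, conjugate by rotations to the duplication of vertex 0.
insertAt : ℕ → List (Subset (2 + k)) → List (Subset (3 + k))
-- The first rotation takes the vertices `i - 1` and `i` modulo `2 + k` to 0 and 1. The last one, by
-- `i - 1` modulo `3 + k`, takes the new vertex 1 to `i`.
insertAt {k} i Fs = map (turnBy (2 + k + i)) (map double (map (turnBy (3 + k ∸ i)) Fs))

_⊑_ : List (Subset n) → List (Subset n) → Set
Gs ⊑ Fs = All (λ S → Any (S ⊆_) Fs) Gs

_⊑?_ : ∀ (Gs Fs : List (Subset n)) → Dec (Gs ⊑ Fs)
Gs ⊑? Fs = All.all? (λ S → Any.any? (S ⊆?_) Fs) Gs

⟨⟩-complex : ∀ {Fs : List (Subset n)} → IsComplex ⟨ Fs ⟩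
⟨⟩-complex S T T⊆S = Any.map (⊆-trans T⊆S)

⊑⇒⊆ₖ : ∀ {Gs Fs : List (Subset n)} → Gs ⊑ Fs → ⟨ Gs ⟩ ⊆ₖ ⟨ Fs ⟩
⊑⇒⊆ₖ Gs⊑Fs T T∈ = let S⊆ , T⊆S = All.lookupAny Gs⊑Fs T∈ in
  ⟨⟩-complex _ _ T⊆S S⊆

insertions : List (List (Subset (2 + k))) → List (List (Subset (3 + k)))
insertions {k} = concatMap λ Fs → map (λ i → insertAt i Fs) (upTo (3 + k))

Inherits : List (List (Subset (2 + k))) → List (List (Subset (3 + k))) → Set
Inherits Old New = All (λ Fs → Any (_⊑ Fs) (insertions Old)) New

inherits? : ∀ (Old : List (List (Subset (2 + k)))) New → Dec (Inherits Old New)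
inherits? Old New = All.all? (λ Fs → Any.any? (_⊑? Fs) (insertions Old)) New

-- Generation is monotone in the complex, so each new complex only has to contain some insertion of
-- an old one, which is a finite check. In this way a single table serves all the required sizes of
-- a family.
inherit : ∀ (Old : List (List (Subset (2 + k)))) New {_ : True (inherits? Old New)} →
          All Generating Old → All Generating New
inherit {k} Old New {inh} old = All.map
  (λ some → let gen , G⊑ = All.lookupAny generating some in generates-mono (⊑⇒⊆ₖ G⊑) gen) (toWitness inh)
  where
  insertion : ∀ i {Fs : List (Subset (2 + k))} → Generating Fs → Generating (insertAt i Fs)
  insertion i = generates-turnBy (2 + k + i) ∘ generates-double ∘ generates-turnBy (3 + k ∸ i)
  generating : All Generating (insertions Old)
  generating = AllP.concat⁺ (AllP.map⁺ (All.map
    (λ gen → AllP.map⁺ (All.universal (λ i → insertion i gen) (upTo (3 + k)))) old))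

Increasing : Fin n × Fin n → Set
Increasing (a , c) = a <F c

increasing? : ∀ (p : Fin n × Fin n) → Dec (Increasing p)
increasing? (a , c) = a Fin.<? c

k₂s : ∀ n → List (List (Subset n))
k₂s n = map (λ (a , c) → k₂ a c) (filter increasing? (cartesianProduct (allFin n) (allFin n)))

K₅Index : ℕ → ℕ × ℕ → Set
K₅Index n (i , j) = 1 < i × i < j × suc j < n

k₅-index? : ∀ n p → Dec (K₅Index n p)
k₅-index? n (i , j) = 1 ℕ.<? i ×-dec i ℕ.<? j ×-dec suc j ℕ.<? n

k₅s : ∀ n .{{_ : ℕ.NonZero n}} → List (List (Subset n))
k₅s n = map (λ (i , j) → k₅ n i j) (filter (k₅-index? n) (cartesianProduct (upTo n) (upTo n)))

k₂s-2 : All Generating (k₂s 2)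
k₂s-2 = generates-k₂ ∷ []

k₂s-3 : All Generating (k₂s 3)
k₂s-3 = inherit (k₂s 2) (k₂s 3) k₂s-2

k₂s-4 : All Generating (k₂s 4)
k₂s-4 = inherit (k₂s 3) (k₂s 4) k₂s-3

k₂s-5 : All Generating (k₂s 5)
k₂s-5 = inherit (k₂s 4) (k₂s 5) k₂s-4

k₂s-6 : All Generating (k₂s 6)
k₂s-6 = inherit (k₂s 5) (k₂s 6) k₂s-5

k₂s-7 : All Generating (k₂s 7)
k₂s-7 = inherit (k₂s 6) (k₂s 7) k₂s-6

k₅s-5 : All Generating (k₅s 5)
-- For n = 5 the conditions on the indices leave only i = 2 and j = 3.
k₅s-5 = generates-k₅ ∷ []

k₅s-6 : All Generating (k₅s 6)
k₅s-6 = inherit (k₅s 5) (k₅s 6) k₅s-5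

k₅s-7 : All Generating (k₅s 7)
k₅s-7 = inherit (k₅s 6) (k₅s 7) k₅s-6

-- With at most 7 vertices, fuel 7 reaches every digit. The number 0 has the one digit 0, so it
-- encodes the singleton and not the empty set.
digits : ℕ → ℕ → List ℕ
digits zero       _ = []
digits (suc fuel) d = d % 10 ∷ (if d / 10 ≡ᵇ 0 then [] else digits fuel (d / 10))

-- The set of the decimal digits of d.
set : ∀ {n} → ℕ → Subset n
set d = tabulate λ i → any (toℕ i ≡ᵇ_) (digits 7 d)

-- Rotations as addition modulo the number of vertices

shift : ℕ → Fin (suc k) → Fin (suc k)
shift {k} c x = (toℕ x + c) mod suc k

toℕ-shift : ∀ c (x : Fin (suc k)) → toℕ (shift c x) ≡ (toℕ x + c) % suc k
toℕ-shift {k} c x = toℕ-fromℕ< (m%n<n (toℕ x + c) (suc k))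

shift-zero : (x : Fin (suc k)) → shift 0 x ≡ x
shift-zero {k} x = toℕ-injective (trans (toℕ-shift 0 x)
  (trans (cong (_% suc k) (ℕₚ.+-identityʳ (toℕ x))) (m<n⇒m%n≡m (toℕ<n x))))

next≡shift : (x : Fin (suc k)) → next x ≡ shift 1 x
next≡shift {k} x with view x
... | ‵fromℕ = toℕ-injective (sym (trans (toℕ-shift 1 (fromℕ k))
  (trans (cong (_% suc k) (trans (cong (_+ 1) (toℕ-fromℕ k)) (ℕₚ.+-comm k 1))) (n%n≡0 (suc k)))))
... | ‵inject₁ j = toℕ-injective (sym (trans (toℕ-shift 1 (inject₁ j))
  (trans (cong (_% suc k) (trans (cong (_+ 1) (toℕ-inject₁ j)) (ℕₚ.+-comm (toℕ j) 1)))
         (m<n⇒m%n≡m (s≤s (toℕ<n j))))))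

next-shift : ∀ c (x : Fin (suc k)) → next (shift c x) ≡ shift (suc c) x
next-shift {k} c x = trans (next≡shift (shift c x)) (toℕ-injective (begin
  toℕ (shift 1 (shift c x)) ≡⟨ toℕ-shift 1 (shift c x) ⟩
  (toℕ (shift c x) + 1) % N ≡⟨ cong (λ y → (y + 1) % N) (toℕ-shift c x) ⟩
  ((toℕ x + c) % N + 1) % N ≡⟨ %-distribˡ-+ ((toℕ x + c) % N) 1 N ⟩
  ((toℕ x + c) % N % N + 1 % N) % N ≡⟨ cong (λ y → (y + 1 % N) % N) (m%n%n≡m%n (toℕ x + c) N) ⟩
  ((toℕ x + c) % N + 1 % N) % N ≡⟨ %-distribˡ-+ (toℕ x + c) 1 N ⟨
  (toℕ x + c + 1) % N ≡⟨ cong (_% N) x+c+1 ⟩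
  (toℕ x + suc c) % N ≡⟨ toℕ-shift (suc c) x ⟨
  toℕ (shift (suc c) x) ∎))
  where
  open ≡-Reasoning
  N = suc k
  x+c+1 : toℕ x + c + 1 ≡ toℕ x + suc c
  x+c+1 = trans (ℕₚ.+-assoc (toℕ x) c 1) (cong (toℕ x +_) (ℕₚ.+-comm c 1))

∈-turnBy⁺ : ∀ c {S : Subset (suc k)} {x} → x ∈ S → shift c x ∈ turnBy c S
∈-turnBy⁺ zero {S} x∈S = subst (_∈ S) (sym (shift-zero _)) x∈S
∈-turnBy⁺ (suc c) {S} {x} x∈S = ∈-preimage⁺ {g = prev}
  (subst (_∈ turnBy c S) (trans (sym (prev-next _)) (cong prev (next-shift c x))) (∈-turnBy⁺ c x∈S))

∈-turnBy⁻ : ∀ c {S : Subset (suc k)} {y} → y ∈ turnBy c S → ∃[ x ] (x ∈ S × shift c x ≡ y)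
∈-turnBy⁻ zero y∈S = _ , y∈S , shift-zero _
∈-turnBy⁻ (suc c) {y = y} y∈ with ∈-turnBy⁻ c (∈-preimage⁻ {g = prev} y∈)
... | x , x∈S , e = x , x∈S , trans (sym (next-shift c x)) (trans (cong next e) (next-prev y))

-- Links the rotation of facets used in computations to `Rot`, which moves every face: a face inside
-- a facet moves into the rotated facet.
turnBy≈Rot : ∀ c (Fs : List (Subset (suc k))) → ⟨ map (turnBy c) Fs ⟩ ≈ₖ Rot c ⟨ Fs ⟩
turnBy≈Rot c Fs = into , out
  where
  into : ⟨ map (turnBy c) Fs ⟩ ⊆ₖ Rot c ⟨ Fs ⟩
  into T T∈ with find (AnyP.map⁻ T∈)
  ... | S , S∈Fs , T⊆ = S , lose S∈Fs id , λ y y∈T → ∈-turnBy⁻ c (T⊆ y∈T)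
  out : Rot c ⟨ Fs ⟩ ⊆ₖ ⟨ map (turnBy c) Fs ⟩
  out T (S , S∈ , T⊆img) = AnyP.map⁺ (Any.map moved S∈)
    where
    moved : ∀ {F} → S ⊆ F → T ⊆ turnBy c F
    moved S⊆F {y} y∈T = let x , x∈S , e = T⊆img y y∈T in subst (_∈ turnBy c _) e (∈-turnBy⁺ c (S⊆F x∈S))

-- Candidate complexes together with their families

≈ₖ-trans : ∀ {K K' K'' : Cx n} → K ≈ₖ K' → K' ≈ₖ K'' → K ≈ₖ K''
≈ₖ-trans (p , q) (p' , q') = (λ S → p' S ∘ p S) , (λ S → q S ∘ q' S)

InFamilies : Cx n → Set₁
InFamilies K = (K₂Family K ⊎ K₅Family K) ⊎ (K₆Family K ⊎ K₇Family K)

-- Membership is asked of every `K ≈ₖ ⟨ Fs ⟩`, because minimality gives mutual inclusion of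
-- predicates and not propositional equality.
Classified : List (Subset n) → Set₁
Classified Fs = Generating Fs × (∀ K → K ≈ₖ ⟨ Fs ⟩ → InFamilies K)

rotations : List (Subset (suc k)) → List (List (Subset (suc k)))
rotations {k} Fs = map (λ c → map (turnBy c) Fs) (upTo (suc k))

rotations-classified : ∀ {Fs : List (Subset (suc k))} → Generating Fs →
  (∀ c K → K ≈ₖ Rot c ⟨ Fs ⟩ → InFamilies K) → All Classified (rotations Fs)
rotations-classified {Fs = Fs} gen member = AllP.map⁺ (All.universal
  (λ c → generates-turnBy c gen , λ K K≈ → member c K (≈ₖ-trans K≈ (turnBy≈Rot c Fs))) (upTo (suc _)))

k₂s-classified : All Generating (k₂s n) → All Classified (k₂s n)
k₂s-classified gens = AllP.map⁺ (All.zipWith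
  (λ { {a , c} (gen , a<c) → gen , λ K K≈ → inj₁ (inj₁ (a , c , <⇒≢ a<c , K≈)) })
  (AllP.map⁻ gens , AllP.all-filter increasing? (cartesianProduct (allFin _) (allFin _))))

k₅s-classified : 5 ≤ suc k → All Generating (k₅s (suc k)) → All Classified (concatMap rotations (k₅s (suc k)))
k₅s-classified {k} 5≤n gens = AllP.concat⁺ (AllP.map⁺ (AllP.map⁺ (All.zipWith
  (λ { {i , j} (gen , 1<i , i<j , j<n) → rotations-classified gen λ c K K≈ →
       inj₁ (inj₂ (5≤n , c , i , j , 1<i , i<j , j<n , K≈)) })
  (AllP.map⁻ gens , AllP.all-filter (k₅-index? (suc k)) (cartesianProduct (upTo (suc k)) (upTo (suc k)))))))

k₇-classified : All Classified (rotations k₇)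
k₇-classified = rotations-classified generates-k₇ λ c K K≈ →
  inj₂ (inj₂ (rot c (base ((λ _ → id) , (λ _ → id))) K≈))

-- Lists of forbidden nonfaces

-- The facets span the largest complex which has none of the nonfaces as a face.
record Case : Set where
  constructor case
  field
    nonfaces facets : List ℕ
    certificate     : Refutation

  nonfaces-of : ∀ n → List (Subset n)
  nonfaces-of n = map set nonfaces

  facets-of : ∀ n → Vec (Subset n) (length (map set facets))
  facets-of n = Vec.fromList (map set facets)

  Checked : ℕ → Set
  Checked n = Covers (nonfaces-of (suc n)) (facets-of (suc n)) ×
              refutes (facets-of (suc n)) [] certificate ≡ true

  checked? : ∀ n → Dec (Checked n)
  checked? n = covers? (nonfaces-of (suc n)) (facets-of (suc n)) ×-dec
               refutes (facets-of (suc n)) [] certificate ≟B true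

  checked⇒refuted : Checked n → Refuted (nonfaces-of (suc n))
  checked⇒refuted {n} (covers , ok) = refutation⇒refuted (facets-of (suc n)) covers certificate ok

open Case

backTurns : ℕ → List (Subset (suc k)) → List (List (Subset (suc k)))
backTurns zero    Ns = []
backTurns (suc c) Ns = Ns ∷ backTurns c (map (preimage next) Ns)

backTurns-refuted : ∀ c {Ns : List (Subset (suc k))} → Refuted Ns → All Refuted (backTurns c Ns)
backTurns-refuted zero    ref = []
backTurns-refuted (suc c) ref = ref ∷ backTurns-refuted c (refuted-map generates-turn ref)

-- The symmetries form a dihedral group: each is a rotation, or the reversal combined with a
-- rotation.
orbit : List (Subset (suc k)) → List (List (Subset (suc k)))
orbit {k} Ns = backTurns (suc k) Ns ++ backTurns (suc k) (map (preimage opposite) Ns)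

orbit-refuted : ∀ {Ns : List (Subset (suc k))} → Refuted Ns → All Refuted (orbit Ns)
orbit-refuted {k} ref =
  AllP.++⁺ (backTurns-refuted (suc k) ref) (backTurns-refuted (suc k) (refuted-map generates-opposite ref))

orbits : ∀ n → List Case → List (List (Subset (suc n)))
orbits n = concatMap λ c → orbit (nonfaces-of c (suc n))

orbits-refuted : ∀ {cs} → All (λ c → Checked c n) cs → All Refuted (orbits n cs)
orbits-refuted ok = AllP.concat⁺ (AllP.map⁺ (All.map (λ {c} → orbit-refuted ∘ checked⇒refuted c) ok))

below-face : ∀ {K : Cx n} → IsComplex K → ∀ {P} → All K P → ∀ {S} → Any (S ⊆_) P → K S
below-face complex faces {S} S⊆ = let KF , S⊆F = All.lookupAny faces S⊆ in complex (Any.lookup S⊆) S S⊆F KF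

above-nonface : ∀ {K : Cx n} → IsComplex K → ∀ {Q} → All (¬_ ∘ K) Q → ∀ {S} → Any (_⊆ S) Q → ¬ K S
above-nonface complex nonfaces {S} ⊆S KS =
  let ¬KF , F⊆S = All.lookupAny nonfaces ⊆S in ¬KF (complex S (Any.lookup ⊆S) F⊆S KS)

-- Decision trees over the faces of a complex

data Tree : Set where
  ask  : ℕ → Tree → Tree → Tree
  stop : Tree

module Decision (Fss Nss : List (List (Subset n))) where

  -- `P` and `Q` collect the faces and the nonfaces learnt on the way to a leaf. They must either
  -- force a whole candidate into the complex or exclude a whole refuted list.
  Settled : (P Q : List (Subset n)) → Set
  Settled P Q = Any (All λ S → Any (S ⊆_) P) Fss ⊎ Any (All λ S → Any (_⊆ S) Q) Nss

  settled? : ∀ P Q → Dec (Settled P Q)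
  settled? P Q = Any.any? (All.all? λ S → Any.any? (S ⊆?_) P) Fss ⊎-dec
                 Any.any? (All.all? λ S → Any.any? (_⊆? S) Q) Nss

  Settles : Tree → (P Q : List (Subset n)) → Set
  Settles (ask d t u) P Q = Settles t (set d ∷ P) Q × Settles u P (set d ∷ Q)
  Settles stop        P Q = Settled P Q

  settles? : ∀ t P Q → Dec (Settles t P Q)
  settles? (ask d t u) P Q = settles? t (set d ∷ P) Q ×-dec settles? u P (set d ∷ Q)
  settles? stop        P Q = settled? P Q

  -- The answers of `K` lead to a leaf, the first subtree of `ask` being taken for a face. A leaf
  -- with a refuted list contradicts generation, so the leaf reached exhibits a candidate inside
  -- `K`.
  decide : ∀ {K : Cx n} → IsComplex K → (∀ S → Dec (K S)) → Generates (Mon n) K → All Refuted Nss →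
           ∀ t {P Q} → Settles t P Q → All K P → All (¬_ ∘ K) Q → Any (All K) Fss
  decide complex K? gen refuted (ask d t u) (yea , nay) faces nonfaces with K? (set d)
  ... | yes Kd = decide complex K? gen refuted t yea (Kd ∷ faces) nonfaces
  ... | no ¬Kd = decide complex K? gen refuted u nay faces (¬Kd ∷ nonfaces)
  decide complex K? gen refuted stop (inj₁ some) faces nonfaces =
    Any.map (All.map (below-face complex faces)) some
  decide complex K? gen refuted stop (inj₂ some) faces nonfaces =
    let ref , below = All.lookupAny refuted some in
    contradiction (All.map (above-nonface complex nonfaces) below) (ref _ gen)

classify : ∀ {Fss : List (List (Subset (suc n)))} cs t → All Classified Fss →
  {_ : True (All.all? (λ c → checked? c n) cs)} {_ : True (Decision.settles? Fss (orbits n cs) t [] [])} →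
  ∀ K → MinimalGenerating (Mon (suc n)) K → InFamilies K
classify {n} {Fss} cs t classified {checked!} {settles!} K
  ((b , m , f , f∈ , onto , W , isW , faces) , minimal) =
  proj₂ good K (K⊆F , F⊆K)
  where
  -- The tree questions the communication complex of `f`, whose faces are decidable, and not the
  -- arbitrary predicate `K`. The candidate found there lies in `K` as well.
  K' : Cx (suc n)
  K' S = ∃[ j ] (∀ i → i ∈ S → j ∈ W i)
  K'? : ∀ S → Dec (K' S)
  K'? S = any? λ j → all? λ i → (i ∈? S) →-dec (j ∈? W i)
  complex : IsComplex K'
  complex S T T⊆S (j , h) = j , λ i i∈T → h i (T⊆S i∈T)
  some : Any (All K') Fss
  some = Decision.decide Fss (orbits n cs) complex K'? (b , m , f , f∈ , onto , W , isW , λ _ → id)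
           (orbits-refuted (toWitness checked!)) t (toWitness settles!) [] []
  F : List (Subset (suc n))
  F = Any.lookup some
  good : Classified F
  good = proj₁ (All.lookupAny classified some)
  F⊆K : ⟨ F ⟩ ⊆ₖ K
  F⊆K S S∈F = faces S (below-face complex (proj₂ (All.lookupAny classified some)) S∈F)
  K⊆F : K ⊆ₖ ⟨ F ⟩
  K⊆F = minimal ⟨ F ⟩ ⟨⟩-complex F⊆K (proj₁ good)

-- The certificates and the trees below were found by computer search.
cases-2 : List Case
cases-2 =
  -- Vertex 0 lies in no face, so bit 0 reads nothing, yet two words differ there.
  (case (0 ∷ [])
      (1 ∷ [])
      (letter 0 0 ⨾ letter 1 0 ⨾ clash 1 0)) ∷
  []

cases-3 : List Case
cases-3 =
  -- Bit 0 shares no input with bits 1 and 2. Fixing these to `true` and `false` forces bit 0 to be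
  -- `true` whatever its own inputs carry.
  (case (10 ∷ 20 ∷ [])
      (21 ∷ 0 ∷ [])
      (letter 0 0 ⨾ letter 2 1 ⨾ letter 2 2 ⨾ infer 0 1 0 ⨾ clash 3 0)) ∷
  []

cases-4 : List Case
cases-4 =
  (case (210 ∷ 310 ∷ 320 ∷ [])
      (321 ∷ 30 ∷ 20 ∷ 10 ∷ [])
      (letter 7 2 ⨾ letter 2 1 ⨾ letter 2 2 ⨾ infer 3 0 1 ⨾ infer 0 2 0 ⨾ infer 3 4 0 ⨾ letter 7 3 ⨾
       clash 1 0)) ∷
  []

cases-5 : List Case
cases-5 =
  (case (210 ∷ 4310 ∷ 4320 ∷ [])
      (4321 ∷ 430 ∷ 420 ∷ 320 ∷ 410 ∷ 310 ∷ [])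
      (letter 8 2 ⨾ letter 2 1 ⨾ letter 2 2 ⨾ infer 3 0 1 ⨾ infer 4 0 2 ⨾ infer 0 3 0 ⨾ infer 3 5 0 ⨾
       infer 4 0 1 ⨾ infer 3 0 7 ⨾ letter 8 3 ⨾ clash 1 0)) ∷
  (case (210 ∷ 4310 ∷ 4321 ∷ [])
      (4320 ∷ 431 ∷ 421 ∷ 321 ∷ 410 ∷ 310 ∷ [])
      (letter 3 2 ⨾ letter 0 4 ⨾ letter 0 0 ⨾ infer 2 1 0 ⨾ infer 3 0 2 ⨾ infer 2 0 2 ⨾ infer 1 0 3 ⨾
       infer 3 6 0 ⨾ infer 0 1 7 ⨾ infer 4 1 0 ⨾ infer 3 0 9 ⨾ letter 3 3 ⨾ clash 1 0)) ∷
  -- These are all the sets with 4 elements: a complex generating `Mon 5` has one of them as a face.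
  (case (3210 ∷ 4210 ∷ 4310 ∷ 4320 ∷ 4321 ∷ [])
      (432 ∷ 431 ∷ 421 ∷ 321 ∷ 430 ∷ 420 ∷ 320 ∷ 410 ∷ 310 ∷ 210 ∷ [])
      (letter 6 0 ⨾ letter 0 4 ⨾ letter 0 0 ⨾ infer 1 1 0 ⨾ infer 2 0 2 ⨾ infer 3 0 3 ⨾ infer 1 0 3 ⨾
       infer 2 0 1 ⨾ letter 4 3 ⨾ letter 4 4 ⨾ infer 0 1 0 ⨾ infer 1 0 2 ⨾ infer 0 0 4 ⨾ infer 4 5 0 ⨾
       infer 3 0 6 ⨾ infer 1 14 0 ⨾ letter 6 1 ⨾ clash 1 0)) ∷
  []

cases-6 : List Case
cases-6 =
  (case (210 ∷ 54310 ∷ 54321 ∷ [])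
      (54320 ∷ 5431 ∷ 5421 ∷ 5321 ∷ 4321 ∷ 5410 ∷ 5310 ∷ 4310 ∷ [])
      (letter 3 2 ⨾ letter 0 5 ⨾ letter 0 0 ⨾ infer 2 1 0 ⨾ infer 4 0 2 ⨾ infer 2 0 2 ⨾ infer 3 0 1 ⨾
       infer 2 0 4 ⨾ infer 1 0 5 ⨾ infer 3 8 0 ⨾ infer 0 1 9 ⨾ infer 4 1 0 ⨾ infer 5 0 1 ⨾ infer 3 0 12 ⨾
       infer 4 0 1 ⨾ infer 3 0 14 ⨾ letter 3 3 ⨾ clash 1 0)) ∷
  (case (210 ∷ 54310 ∷ 54320 ∷ [])
      (54321 ∷ 5430 ∷ 5420 ∷ 5320 ∷ 4320 ∷ 5410 ∷ 5310 ∷ 4310 ∷ [])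
      (letter 9 2 ⨾ letter 2 1 ⨾ letter 2 2 ⨾ infer 3 0 1 ⨾ infer 4 0 2 ⨾ infer 5 0 3 ⨾ infer 0 4 0 ⨾
       infer 3 6 0 ⨾ infer 4 0 1 ⨾ infer 5 0 2 ⨾ infer 3 0 9 ⨾ infer 4 0 1 ⨾ infer 3 0 11 ⨾ letter 9 3 ⨾
       clash 1 0)) ∷
  (case (3210 ∷ 54210 ∷ 5430 ∷ [])
      (54321 ∷ 5420 ∷ 5320 ∷ 4320 ∷ 5410 ∷ 5310 ∷ 4310 ∷ 5210 ∷ 4210 ∷ [])
      (letter 10 3 ⨾ letter 3 2 ⨾ letter 3 3 ⨾ infer 1 1 0 ⨾ infer 4 1 0 ⨾ infer 5 0 1 ⨾ infer 4 0 3 ⨾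
       infer 1 5 2 ⨾ infer 5 1 0 ⨾ infer 1 7 0 ⨾ infer 0 0 1 ⨾ infer 4 10 0 ⨾ infer 5 0 1 ⨾ infer 4 0 12 ⨾
       letter 10 4 ⨾ clash 1 0)) ∷
  (case (3210 ∷ 5410 ∷ 54320 ∷ [])
      (54321 ∷ 5430 ∷ 5420 ∷ 5320 ∷ 4320 ∷ 5310 ∷ 4310 ∷ 5210 ∷ 4210 ∷ [])
      (letter 8 1 ⨾ letter 4 3 ⨾ letter 4 4 ⨾ infer 1 1 0 ⨾ infer 2 0 2 ⨾ infer 1 0 2 ⨾ infer 5 3 0 ⨾
       infer 1 5 0 ⨾ infer 2 0 6 ⨾ infer 1 0 2 ⨾ infer 0 0 3 ⨾ infer 2 10 0 ⨾ infer 3 0 1 ⨾ infer 2 0 12 ⨾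
       letter 8 2 ⨾ clash 1 0)) ∷
  (case (43210 ∷ 53210 ∷ 54210 ∷ 54310 ∷ 54320 ∷ 54321 ∷ [])
      (5432 ∷ 5431 ∷ 5421 ∷ 5321 ∷ 4321 ∷ 5430 ∷ 5420 ∷ 5320 ∷ 4320 ∷ 5410 ∷ 5310 ∷ 4310 ∷ 5210 ∷ 4210 ∷
       3210 ∷ [])
      (letter 0 0 ⨾ letter 0 5 ⨾ infer 1 0 1 ⨾ infer 2 0 1 ⨾ infer 3 0 2 ⨾ infer 4 0 3 ⨾ infer 1 0 5 ⨾
       infer 2 0 1 ⨾ infer 3 0 2 ⨾ infer 1 0 8 ⨾ infer 2 0 1 ⨾ letter 1 0 ⨾ letter 1 1 ⨾ infer 2 0 1 ⨾
       infer 3 0 2 ⨾ infer 4 0 3 ⨾ infer 5 0 4 ⨾ infer 2 0 4 ⨾ infer 3 0 1 ⨾ infer 4 0 2 ⨾ infer 2 0 7 ⨾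
       infer 3 0 1 ⨾ letter 4 3 ⨾ letter 4 4 ⨾ infer 0 1 0 ⨾ infer 1 0 2 ⨾ infer 2 0 3 ⨾ infer 5 3 2 ⨾
       infer 0 1 4 ⨾ infer 1 0 2 ⨾ infer 0 0 6 ⨾ infer 5 7 0 ⨾ infer 0 9 4 ⨾ infer 1 0 10 ⨾ infer 2 0 11 ⨾
       infer 0 0 3 ⨾ infer 1 0 1 ⨾ letter 5 4 ⨾ letter 5 5 ⨾ infer 0 1 0 ⨾ infer 1 0 2 ⨾ infer 2 0 3 ⨾
       infer 3 0 4 ⨾ infer 0 0 4 ⨾ infer 1 0 1 ⨾ infer 2 0 2 ⨾ infer 0 0 7 ⨾ infer 1 0 1 ⨾ letter 8 1 ⨾
       letter 8 2 ⨾ infer 0 1 0 ⨾ infer 3 1 0 ⨾ infer 4 0 1 ⨾ infer 5 0 2 ⨾ infer 1 32 0 ⨾ infer 3 1 5 ⨾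
       infer 4 0 2 ⨾ infer 3 0 7 ⨾ infer 0 9 6 ⨾ infer 4 1 0 ⨾ infer 5 0 1 ⨾ infer 4 0 3 ⨾ infer 0 13 2 ⨾
       infer 5 1 0 ⨾ infer 0 9 0 ⨾ letter 9 2 ⨾ letter 9 3 ⨾ infer 0 1 0 ⨾ infer 1 0 2 ⨾ infer 4 2 1 ⨾
       infer 5 0 2 ⨾ infer 4 0 34 ⨾ infer 3 0 35 ⨾ infer 2 0 36 ⨾ infer 0 5 7 ⨾ infer 4 8 0 ⨾ infer 5 0 1 ⨾
       infer 4 0 3 ⨾ infer 4 1 11 ⨾ infer 0 13 9 ⨾ infer 5 2 0 ⨾ infer 1 1 15 ⨾ infer 0 0 3 ⨾ infer 5 5 0 ⨾
       infer 0 18 3 ⨾ infer 1 0 19 ⨾ infer 0 0 2 ⨾ infer 1 44 47 ⨾ infer 2 0 45 ⨾ infer 1 0 49 ⨾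
       infer 5 81 0 ⨾ infer 4 0 82 ⨾ infer 0 44 0 ⨾
       -- The 15 facets carry different letters here, so no word prescribes the bit and both values
       -- are pursued.
       split 1 (0 ∷ 4 ∷ 4 ∷ 8 ∷ 1 ∷ 0 ∷ 0 ∷ 0 ∷ 0 ∷ 8 ∷ 8 ∷ 4 ∷ 8 ∷ 4 ∷ 4 ∷ [])
         (infer 0 0 30 ⨾ infer 4 21 0 ⨾ infer 5 0 31 ⨾ infer 4 0 23 ⨾ infer 4 63 3 ⨾ infer 5 0 34 ⨾
          infer 4 0 65 ⨾
          split 2 (4 ∷ 0 ∷ 4 ∷ 4 ∷ 4 ∷ 0 ∷ 4 ∷ 4 ∷ 4 ∷ 0 ∷ 0 ∷ 0 ∷ 4 ∷ 4 ∷ 0 ∷ [])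
            (infer 3 0 70 ⨾ infer 1 0 2 ⨾ infer 0 0 6 ⨾ infer 2 0 96 ⨾ infer 5 44 1 ⨾ infer 5 61 2 ⨾
             infer 4 2 60 ⨾ infer 0 87 2 ⨾ infer 3 2 64 ⨾ infer 0 63 2 ⨾ infer 4 6 0 ⨾ infer 2 3 91 ⨾
             infer 4 0 2 ⨾ infer 5 4 28 ⨾ infer 0 1 32 ⨾ infer 1 0 4 ⨾ infer 3 0 5 ⨾ infer 3 1 4 ⨾
             infer 0 0 13 ⨾ infer 2 0 1 ⨾ infer 0 85 3 ⨾ infer 5 1 0 ⨾ clash 8 0)
            (infer 3 0 1 ⨾ infer 0 0 71 ⨾ infer 1 0 1 ⨾ infer 0 0 94 ⨾ infer 3 95 0 ⨾ infer 0 2 0 ⨾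
             infer 4 1 60 ⨾ infer 2 1 25 ⨾ infer 0 62 1 ⨾ infer 4 1 27 ⨾ infer 2 0 4 ⨾ infer 2 1 2 ⨾
             infer 4 1 17 ⨾ infer 3 0 1 ⨾ clash 94 0))
         (infer 2 0 30 ⨾ infer 3 0 31 ⨾ infer 4 0 32 ⨾ infer 0 75 0 ⨾ infer 2 0 76 ⨾ infer 0 0 2 ⨾
          infer 4 1 7 ⨾ infer 5 55 1 ⨾ infer 3 0 56 ⨾ infer 3 6 8 ⨾ infer 0 0 3 ⨾ infer 5 4 0 ⨾
          infer 1 3 0 ⨾ infer 3 0 20 ⨾ infer 5 0 21 ⨾ infer 3 0 2 ⨾ infer 2 0 3 ⨾ clash 100 0))) ∷
  []

cases-7 : List Case
cases-7 =
  (case (210 ∷ 654310 ∷ 654321 ∷ [])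
      (654320 ∷ 65431 ∷ 65421 ∷ 65321 ∷ 64321 ∷ 54321 ∷ 65410 ∷ 65310 ∷ 64310 ∷ 54310 ∷ [])
      (letter 3 2 ⨾ letter 0 6 ⨾ letter 0 0 ⨾ infer 2 1 0 ⨾ infer 5 0 2 ⨾ infer 2 0 2 ⨾ infer 4 0 1 ⨾
       infer 2 0 4 ⨾ infer 3 0 1 ⨾ infer 2 0 6 ⨾ infer 1 0 7 ⨾ infer 3 10 0 ⨾ infer 0 1 11 ⨾ infer 4 1 0 ⨾
       infer 5 0 1 ⨾ infer 6 0 2 ⨾ infer 3 0 15 ⨾ infer 4 0 1 ⨾ infer 5 0 2 ⨾ infer 3 0 18 ⨾ infer 4 0 1 ⨾
       infer 3 0 20 ⨾ letter 3 3 ⨾ clash 1 0)) ∷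
  (case (210 ∷ 654310 ∷ 654320 ∷ [])
      (654321 ∷ 65430 ∷ 65420 ∷ 65320 ∷ 64320 ∷ 54320 ∷ 65410 ∷ 65310 ∷ 64310 ∷ 54310 ∷ [])
      (letter 10 2 ⨾ letter 2 1 ⨾ letter 2 2 ⨾ infer 3 0 1 ⨾ infer 4 0 2 ⨾ infer 5 0 3 ⨾ infer 6 0 4 ⨾
       infer 0 5 0 ⨾ infer 3 7 0 ⨾ infer 4 0 1 ⨾ infer 5 0 2 ⨾ infer 6 0 3 ⨾ infer 3 0 11 ⨾ infer 4 0 1 ⨾
       infer 5 0 2 ⨾ infer 3 0 14 ⨾ infer 4 0 1 ⨾ infer 3 0 16 ⨾ letter 10 3 ⨾ clash 1 0)) ∷
  (case (3210 ∷ 654210 ∷ 65430 ∷ [])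
      (654321 ∷ 65420 ∷ 65320 ∷ 64320 ∷ 54320 ∷ 65410 ∷ 65310 ∷ 64310 ∷ 54310 ∷ 65210 ∷ 64210 ∷ 54210 ∷ [])
      (letter 11 3 ⨾ letter 3 2 ⨾ letter 3 3 ⨾ infer 1 1 0 ⨾ infer 4 1 0 ⨾ infer 1 3 0 ⨾ infer 5 1 0 ⨾
       infer 1 5 0 ⨾ infer 6 1 0 ⨾ infer 1 7 0 ⨾ infer 0 0 1 ⨾ infer 4 10 0 ⨾ infer 5 0 1 ⨾ infer 6 0 2 ⨾
       infer 4 0 13 ⨾ infer 5 0 1 ⨾ infer 4 0 15 ⨾ letter 11 4 ⨾ clash 1 0)) ∷
  (case (43210 ∷ 65210 ∷ 65430 ∷ [])
      (654321 ∷ 65420 ∷ 65320 ∷ 64320 ∷ 54320 ∷ 65410 ∷ 65310 ∷ 64310 ∷ 54310 ∷ 64210 ∷ 54210 ∷ 63210 ∷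
       53210 ∷ [])
      (letter 12 4 ⨾ letter 12 5 ⨾ infer 1 1 0 ⨾ infer 2 0 2 ⨾ infer 3 0 3 ⨾ infer 1 0 3 ⨾ infer 2 0 1 ⨾
       infer 1 0 5 ⨾ infer 6 6 0 ⨾ letter 3 2 ⨾ letter 3 3 ⨾ infer 1 1 0 ⨾ infer 4 1 0 ⨾ infer 5 0 1 ⨾
       infer 6 0 2 ⨾ infer 4 0 4 ⨾ infer 5 0 1 ⨾ infer 4 0 6 ⨾ infer 1 8 5 ⨾ infer 5 1 0 ⨾ infer 6 0 1 ⨾
       infer 5 0 3 ⨾ infer 1 12 2 ⨾ infer 6 1 0 ⨾ infer 1 14 0 ⨾ infer 0 0 1 ⨾ infer 3 17 0 ⨾
       infer 4 0 18 ⨾ clash 27 0)) ∷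
  (case (3210 ∷ 65410 ∷ 654321 ∷ [])
      (654320 ∷ 65431 ∷ 65421 ∷ 65321 ∷ 64321 ∷ 54321 ∷ 65310 ∷ 64310 ∷ 54310 ∷ 65210 ∷ 64210 ∷ 54210 ∷ [])
      (letter 0 6 ⨾ letter 0 0 ⨾ infer 2 1 0 ⨾ infer 3 0 2 ⨾ infer 5 0 3 ⨾ infer 2 0 3 ⨾ infer 3 0 1 ⨾
       infer 4 0 2 ⨾ infer 2 0 6 ⨾ infer 3 0 1 ⨾ infer 2 0 8 ⨾ infer 1 0 9 ⨾ letter 4 3 ⨾ letter 4 4 ⨾
       infer 0 1 0 ⨾ infer 2 0 2 ⨾ infer 0 0 2 ⨾ infer 5 3 0 ⨾ infer 0 5 0 ⨾ infer 2 0 6 ⨾ infer 0 0 2 ⨾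
       infer 6 3 0 ⨾ infer 0 9 0 ⨾ infer 2 0 10 ⨾ infer 0 0 2 ⨾ infer 1 0 1 ⨾ clash 14 0)) ∷
  (case (3210 ∷ 65410 ∷ 654320 ∷ [])
      (654321 ∷ 65430 ∷ 65420 ∷ 65320 ∷ 64320 ∷ 54320 ∷ 65310 ∷ 64310 ∷ 54310 ∷ 65210 ∷ 64210 ∷ 54210 ∷ [])
      (letter 2 1 ⨾ letter 2 2 ⨾ infer 3 0 1 ⨾ infer 4 0 2 ⨾ infer 5 0 3 ⨾ infer 6 0 4 ⨾ infer 0 5 0 ⨾
       letter 11 3 ⨾ letter 11 4 ⨾ infer 1 1 0 ⨾ infer 2 0 2 ⨾ infer 1 0 2 ⨾ infer 5 3 0 ⨾ infer 1 5 0 ⨾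
       infer 2 0 6 ⨾ infer 1 0 2 ⨾ infer 6 3 0 ⨾ infer 1 9 0 ⨾ infer 2 0 10 ⨾ infer 1 0 2 ⨾ infer 0 0 3 ⨾
       clash 14 0)) ∷
  (case (43210 ∷ 65210 ∷ 654310 ∷ 654320 ∷ 654321 ∷ [])
      (65432 ∷ 65431 ∷ 65421 ∷ 65321 ∷ 64321 ∷ 54321 ∷ 65430 ∷ 65420 ∷ 65320 ∷ 64320 ∷ 54320 ∷ 65410 ∷
       65310 ∷ 64310 ∷ 54310 ∷ 64210 ∷ 54210 ∷ 63210 ∷ 53210 ∷ [])
      (letter 10 2 ⨾ letter 5 4 ⨾ letter 5 5 ⨾ infer 0 1 0 ⨾ infer 1 0 2 ⨾ infer 2 0 3 ⨾ infer 0 0 3 ⨾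
       infer 3 1 5 ⨾ infer 1 0 4 ⨾ infer 2 0 1 ⨾ infer 1 3 0 ⨾ infer 0 0 8 ⨾ infer 6 9 0 ⨾ infer 0 11 0 ⨾
       infer 1 0 12 ⨾ infer 2 0 13 ⨾ infer 3 0 14 ⨾ infer 0 9 14 ⨾ infer 1 0 10 ⨾ infer 2 0 11 ⨾
       infer 0 0 17 ⨾ infer 1 0 1 ⨾ infer 0 0 19 ⨾ infer 6 20 0 ⨾ infer 0 7 0 ⨾ infer 1 0 8 ⨾ infer 2 0 9 ⨾
       infer 0 0 3 ⨾ infer 1 0 1 ⨾ letter 0 6 ⨾ letter 0 0 ⨾ infer 1 1 0 ⨾ infer 2 0 2 ⨾ infer 3 0 3 ⨾
       infer 4 0 4 ⨾ infer 5 0 5 ⨾ infer 1 0 5 ⨾ infer 2 0 1 ⨾ infer 3 0 2 ⨾ infer 4 0 3 ⨾ infer 1 0 9 ⨾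
       infer 2 0 1 ⨾ infer 3 0 2 ⨾ infer 1 0 12 ⨾ infer 2 0 1 ⨾ infer 0 16 0 ⨾ infer 4 1 0 ⨾ infer 3 0 2 ⨾
       infer 3 3 2 ⨾ infer 0 20 0 ⨾ infer 4 2 0 ⨾ infer 0 22 0 ⨾ infer 3 51 0 ⨾ infer 4 0 1 ⨾
       infer 3 0 53 ⨾ letter 10 3 ⨾ clash 1 0)) ∷
  (case (43210 ∷ 54321 ∷ 653210 ∷ 654210 ∷ 654310 ∷ 654320 ∷ [])
      (65432 ∷ 65431 ∷ 65421 ∷ 65321 ∷ 64321 ∷ 65430 ∷ 65420 ∷ 65320 ∷ 64320 ∷ 54320 ∷ 65410 ∷ 65310 ∷
       64310 ∷ 54310 ∷ 65210 ∷ 64210 ∷ 54210 ∷ 63210 ∷ 53210 ∷ [])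
      (letter 3 2 ⨾ letter 3 3 ⨾ infer 1 1 0 ⨾ infer 4 1 0 ⨾ infer 0 1 0 ⨾ infer 4 3 0 ⨾ infer 5 0 1 ⨾
       infer 6 0 2 ⨾ infer 4 0 6 ⨾ infer 5 0 1 ⨾ infer 4 0 8 ⨾ infer 1 10 7 ⨾ infer 0 0 1 ⨾ infer 5 2 0 ⨾
       infer 6 0 1 ⨾ infer 5 0 4 ⨾ infer 1 15 2 ⨾ infer 0 0 1 ⨾ infer 6 2 0 ⨾ infer 1 18 0 ⨾ infer 0 0 1 ⨾
       infer 1 0 20 ⨾ letter 4 3 ⨾ letter 4 4 ⨾ infer 1 1 0 ⨾ infer 2 0 2 ⨾ infer 1 0 2 ⨾ infer 0 0 3 ⨾
       infer 5 4 0 ⨾ infer 6 0 1 ⨾ infer 5 0 6 ⨾ infer 1 8 2 ⨾ infer 2 0 9 ⨾ infer 1 0 2 ⨾ infer 0 0 3 ⨾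
       infer 6 4 0 ⨾ infer 1 13 0 ⨾ infer 0 0 1 ⨾ infer 2 1 15 ⨾ infer 1 0 3 ⨾ infer 0 0 4 ⨾ infer 1 3 18 ⨾
       infer 2 0 19 ⨾ letter 8 1 ⨾ letter 9 1 ⨾ letter 9 2 ⨾ infer 3 0 1 ⨾ infer 4 0 2 ⨾ infer 0 3 0 ⨾
       infer 4 2 0 ⨾ infer 5 0 1 ⨾ infer 6 0 2 ⨾ infer 4 0 5 ⨾ infer 5 0 1 ⨾ infer 4 0 7 ⨾ infer 2 0 34 ⨾
       infer 1 0 35 ⨾ infer 0 12 6 ⨾ infer 6 4 0 ⨾ infer 0 14 0 ⨾ infer 3 14 11 ⨾ infer 4 0 1 ⨾
       infer 5 0 2 ⨾ infer 6 0 3 ⨾ infer 3 0 18 ⨾ infer 4 0 1 ⨾ infer 5 0 2 ⨾ infer 3 0 21 ⨾ infer 4 0 1 ⨾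
       infer 3 0 12 ⨾ infer 3 1 24 ⨾ letter 12 4 ⨾ letter 0 0 ⨾ letter 0 5 ⨾ infer 1 0 1 ⨾ infer 2 0 1 ⨾
       infer 3 0 2 ⨾ infer 4 0 3 ⨾ infer 1 0 5 ⨾ infer 2 0 1 ⨾ infer 3 0 2 ⨾ infer 1 0 8 ⨾ infer 2 0 1 ⨾
       infer 1 0 10 ⨾ letter 8 0 ⨾ infer 2 41 0 ⨾ infer 3 0 1 ⨾ infer 4 0 2 ⨾ infer 5 0 3 ⨾ infer 6 0 4 ⨾
       infer 2 0 46 ⨾ infer 3 0 1 ⨾ infer 4 0 2 ⨾ infer 5 0 3 ⨾ infer 2 0 50 ⨾ infer 3 0 1 ⨾ infer 4 0 2 ⨾
       infer 2 0 53 ⨾ infer 3 0 1 ⨾ letter 12 5 ⨾ infer 1 28 0 ⨾ infer 2 0 29 ⨾ infer 3 0 30 ⨾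
       infer 1 0 3 ⨾ infer 2 0 1 ⨾ infer 1 0 5 ⨾ infer 0 0 6 ⨾ infer 6 7 0 ⨾ infer 1 36 0 ⨾ infer 2 0 37 ⨾
       infer 3 0 38 ⨾ infer 1 1 3 ⨾ infer 0 0 4 ⨾ infer 2 2 4 ⨾ infer 3 0 73 ⨾ infer 4 0 74 ⨾
       infer 5 0 75 ⨾ infer 6 0 76 ⨾ infer 5 0 2 ⨾ infer 1 8 11 ⨾ infer 2 0 9 ⨾ infer 1 0 13 ⨾
       infer 0 0 14 ⨾ infer 1 10 51 ⨾ infer 2 0 52 ⨾ infer 3 0 53 ⨾ infer 1 0 3 ⨾ infer 2 0 1 ⨾
       infer 1 0 5 ⨾ infer 3 1 13 ⨾ letter 0 6 ⨾ infer 2 0 47 ⨾ infer 3 0 1 ⨾ infer 4 0 2 ⨾ infer 5 0 3 ⨾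
       infer 2 0 51 ⨾ infer 3 0 1 ⨾ infer 4 0 2 ⨾ infer 2 0 54 ⨾ infer 3 0 1 ⨾ infer 2 0 56 ⨾
       infer 1 98 100 ⨾ infer 2 43 98 ⨾
       split 4 (0 ∷ 0 ∷ 0 ∷ 0 ∷ 0 ∷ 0 ∷ 8 ∷ 0 ∷ 0 ∷ 12 ∷ 12 ∷ 0 ∷ 8 ∷ 8 ∷ 0 ∷ 0 ∷ 0 ∷ 0 ∷ 0 ∷ [])
         (split 2 (12 ∷ 0 ∷ 12 ∷ 9 ∷ 9 ∷ 0 ∷ 12 ∷ 12 ∷ 12 ∷ 12 ∷ 0 ∷ 0 ∷ 0 ∷ 0 ∷ 12 ∷ 9 ∷ 12 ∷ 9 ∷ 9 ∷ [])
            (infer 1 0 22 ⨾ infer 4 75 0 ⨾ infer 0 1 0 ⨾ infer 4 77 0 ⨾ infer 5 0 1 ⨾ infer 6 0 21 ⨾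
             infer 0 22 0 ⨾ infer 4 53 0 ⨾ infer 2 1 13 ⨾ infer 4 111 2 ⨾ infer 2 3 144 ⨾ infer 0 2 3 ⨾
             infer 1 0 3 ⨾ infer 5 5 1 ⨾ infer 6 0 2 ⨾ infer 5 0 7 ⨾ infer 1 33 0 ⨾ infer 5 7 4 ⨾
             infer 0 1 0 ⨾ infer 6 1 0 ⨾ infer 0 3 0 ⨾ infer 1 11 145 ⨾ infer 3 0 12 ⨾ infer 3 12 127 ⨾
             infer 5 0 128 ⨾ infer 6 0 129 ⨾ infer 3 0 15 ⨾ infer 5 0 1 ⨾ infer 3 0 17 ⨾ infer 3 8 30 ⨾
             infer 2 0 9 ⨾ infer 3 0 135 ⨾ infer 5 0 136 ⨾ infer 6 0 137 ⨾ infer 3 0 3 ⨾ infer 5 0 1 ⨾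
             infer 3 0 40 ⨾ infer 3 1 6 ⨾ infer 1 15 152 ⨾ infer 0 162 10 ⨾ infer 5 11 0 ⨾ infer 6 0 129 ⨾
             infer 0 130 0 ⨾ infer 5 5 0 ⨾ infer 6 0 1 ⨾ infer 5 0 7 ⨾ infer 4 0 9 ⨾ infer 2 0 26 ⨾
             infer 4 94 0 ⨾ infer 1 1 0 ⨾ infer 4 96 0 ⨾ infer 0 1 0 ⨾ infer 1 0 4 ⨾ clash 14 0)
            (infer 3 0 22 ⨾ infer 4 0 23 ⨾ infer 3 0 90 ⨾ infer 3 1 3 ⨾ infer 4 0 89 ⨾ infer 5 0 90 ⨾
             infer 6 0 91 ⨾ infer 4 0 3 ⨾ infer 5 0 1 ⨾ infer 2 28 0 ⨾ infer 1 0 1 ⨾ infer 0 0 89 ⨾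
             infer 6 90 0 ⨾ infer 0 2 0 ⨾ infer 4 60 0 ⨾ infer 2 1 20 ⨾ infer 4 118 2 ⨾ infer 2 3 151 ⨾
             infer 0 2 3 ⨾ infer 1 0 3 ⨾ infer 5 5 1 ⨾ infer 6 0 2 ⨾ infer 5 0 7 ⨾ infer 1 13 0 ⨾
             infer 5 100 4 ⨾ infer 0 1 0 ⨾ infer 6 1 0 ⨾ infer 0 3 0 ⨾ infer 1 11 152 ⨾ infer 3 0 12 ⨾
             infer 3 12 134 ⨾ infer 5 0 135 ⨾ infer 6 0 136 ⨾ infer 3 0 15 ⨾ infer 5 0 1 ⨾ infer 3 0 17 ⨾
             infer 1 6 150 ⨾ infer 0 160 1 ⨾ infer 5 2 0 ⨾ infer 6 0 127 ⨾ infer 0 128 0 ⨾ infer 5 56 0 ⨾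
             infer 6 0 1 ⨾ infer 5 0 58 ⨾ infer 0 7 158 ⨾ infer 1 0 15 ⨾ infer 6 72 0 ⨾ infer 6 161 2 ⨾
             infer 1 18 0 ⨾ infer 0 0 2 ⨾ infer 1 0 125 ⨾ infer 2 0 48 ⨾ infer 4 0 24 ⨾ infer 1 0 9 ⨾
             infer 3 0 1 ⨾ infer 1 0 81 ⨾ infer 1 1 12 ⨾ infer 4 41 1 ⨾ infer 0 2 0 ⨾ infer 3 43 0 ⨾
             infer 4 0 3 ⨾ infer 0 4 0 ⨾ infer 4 2 0 ⨾ clash 48 0))
         (infer 5 0 4 ⨾ infer 1 5 0 ⨾ infer 2 0 6 ⨾ infer 0 0 50 ⨾ infer 5 51 0 ⨾ infer 6 0 1 ⨾
          infer 5 0 53 ⨾ infer 1 23 0 ⨾ infer 6 7 12 ⨾ infer 0 13 0 ⨾ infer 1 0 14 ⨾ infer 2 0 15 ⨾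
          infer 1 0 2 ⨾ infer 1 1 6 ⨾ infer 2 1 142 ⨾ infer 4 0 143 ⨾ infer 2 0 31 ⨾ infer 2 1 4 ⨾
          infer 0 20 2 ⨾ infer 6 3 0 ⨾ infer 0 22 0 ⨾ infer 4 4 0 ⨾ infer 3 0 5 ⨾ infer 5 0 148 ⨾
          infer 4 0 6 ⨾ infer 5 2 148 ⨾ infer 6 0 149 ⨾ infer 5 0 4 ⨾ infer 4 0 10 ⨾ infer 2 4 113 ⨾
          infer 1 0 23 ⨾ infer 0 32 6 ⨾ infer 6 3 0 ⨾ infer 0 34 0 ⨾ infer 4 107 3 ⨾ infer 5 0 21 ⨾
          infer 6 0 22 ⨾ infer 0 23 0 ⨾ infer 6 2 30 ⨾ infer 0 31 0 ⨾ infer 4 85 0 ⨾ infer 2 1 12 ⨾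
          infer 5 1 4 ⨾ infer 6 0 5 ⨾ infer 5 0 3 ⨾ infer 5 8 10 ⨾ infer 4 4 48 ⨾ infer 3 0 5 ⨾
          infer 1 0 3 ⨾ infer 0 0 3 ⨾ infer 6 4 0 ⨾ infer 0 2 0 ⨾ clash 18 0))) ∷
  []

tree-2 : Tree
tree-2 =
  ask 0 (ask 1 stop stop) stop

tree-3 : Tree
tree-3 =
  ask 10 (ask 21 stop (ask 20 stop stop)) (ask 20 (ask 21 stop stop) stop)

tree-4 : Tree
tree-4 =
  ask 210
   (ask 310 stop (ask 320 stop (ask 321 stop stop)))
   (ask 310 (ask 321 stop (ask 320 stop stop)) (ask 320 (ask 321 stop stop) stop))

tree-5 : Tree
tree-5 =
  ask 3210
   (ask 4310 stop
     (ask 4320 stop (ask 4321 stop (ask 4210 stop (ask 410 (ask 430 (ask 432 stop stop) stop) stop)))))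
   (ask 4210
     (ask 4310 stop (ask 4320 stop (ask 4321 stop (ask 321 (ask 430 (ask 432 stop stop) stop) stop))))
     (ask 430
       (ask 432
         (ask 4320
           (ask 4310 stop (ask 4321 stop (ask 210 (ask 321 (ask 410 stop stop) stop) stop)))
           (ask 321
             (ask 410
               (ask 210 (ask 4310 stop (ask 4321 stop stop)) (ask 4310 (ask 4321 stop stop) stop))
               stop)
             stop))
         stop)
       stop))

tree-6 : Tree
tree-6 =
  ask 43210
   (ask 54320 stop
     (ask 54210 stop
       (ask 53210 stop
         (ask 54321 stop
           (ask 54310 stop
             (ask 510
               (ask 540
                 (ask 543
                   (ask 5210
                     (ask 5432 stop (ask 5410 stop stop))
                     (ask 5430 (ask 5432 stop stop) stop))
                   stop)
                 stop)
               stop))))))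
   (ask 510
     (ask 540
       (ask 543
         (ask 53210
           (ask 54310 stop
             (ask 54321 stop
               (ask 54320 stop
                 (ask 54210 stop
                   (ask 432
                     (ask 4321
                       (ask 5410 stop (ask 5432 stop stop))
                       (ask 5410 (ask 5430 stop stop) stop))
                     stop)))))
           (ask 432
             (ask 54210
               (ask 54310 stop
                 (ask 54321 stop
                   (ask 54320 stop
                     (ask 321
                       (ask 3210
                         (ask 4321 stop (ask 5430 stop stop))
                         (ask 5430 (ask 5432 stop stop) stop))
                       stop))))
               (ask 321
                 (ask 5430
                   (ask 5432
                     (ask 54310
                       (ask 54320 stop
                         (ask 54321 stop (ask 5210 stop (ask 210 (ask 4321 stop stop) stop))))
                       (ask 54320
                         (ask 54321 stop
                           (ask 210
                             (ask 3210
                               (ask 4321 stop (ask 5210 (ask 5410 stop stop) stop))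
                               (ask 5410 (ask 5210 stop (ask 4321 stop stop)) stop))
                             stop))
                         (ask 210 (ask 54321 (ask 3210 stop (ask 5410 stop stop)) stop) stop)))
                     (ask 210
                       (ask 3210 (ask 5210 (ask 5410 (ask 54310 stop stop) stop) stop) stop)
                       stop))
                   (ask 210
                     (ask 3210 (ask 4321 (ask 5210 (ask 54321 stop stop) stop) stop) stop)
                     stop))
                 (ask 54310 (ask 54320 stop stop) stop)))
             (ask 210 (ask 54210 (ask 54310 stop stop) stop) stop)))
         (ask 210
           (ask 321
             (ask 3210 (ask 5210 (ask 53210 (ask 5410 (ask 54210 stop stop) stop) stop) stop) stop)
             stop)
           stop))
       (ask 210
         (ask 321
           (ask 3210
             (ask 432 (ask 4321 (ask 5210 (ask 53210 (ask 54321 stop stop) stop) stop) stop) stop)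
             stop)
           stop)
         stop))
     (ask 321 (ask 432 (ask 4321 (ask 54320 (ask 54321 stop stop) stop) stop) stop) stop))

tree-7 : Tree
tree-7 =
  ask 3210
   (ask 5432
     (ask 654210
       (ask 543210 stop
         (ask 654310 stop
           (ask 654320 stop
             (ask 653210 stop
               (ask 654321 stop
                 (ask 643210 stop
                   (ask 65430 stop
                     (ask 4321
                       (ask 43210
                         (ask 63210 stop (ask 54321 (ask 6543 (ask 65432 stop stop) stop) stop))
                         (ask 6543 (ask 54321 stop (ask 63210 stop stop)) stop))
                       stop))))))))
       (ask 6543
         (ask 654310
           (ask 543210 stop
             (ask 653210 stop
               (ask 65210 stop
                 (ask 654321 stop
                   (ask 643210 stop
                     (ask 654320 stop
                       (ask 4321
                         (ask 43210
                           (ask 6210 stop (ask 54321 (ask 65432 stop stop) stop))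
                           (ask 65432 (ask 54321 stop (ask 6210 stop stop)) stop))
                         stop)))))))
           (ask 4321
             (ask 653210
               (ask 65410 stop
                 (ask 654320 stop
                   (ask 654321 stop
                     (ask 543210 stop
                       (ask 643210 stop
                         (ask 43210
                           (ask 54321 stop (ask 6540 stop stop))
                           (ask 6540 (ask 65432 stop stop) stop)))))))
               (ask 6210
                 (ask 6540
                   (ask 543210
                     (ask 654321 stop
                       (ask 65410 stop
                         (ask 654320 stop
                           (ask 643210 stop
                             (ask 65432 stop (ask 63210 (ask 6510 stop stop) stop))))))
                     (ask 654321
                       (ask 43210 stop
                         (ask 65210 stop
                           (ask 654320 stop
                             (ask 6510 (ask 65430 (ask 65410 stop stop) stop) stop))))
                       (ask 643210
                         (ask 654320 stop
                           (ask 65210 stop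
                             (ask 54321
                               (ask 65432 stop (ask 6510 stop stop))
                               (ask 6510 (ask 65430 stop stop) stop))))
                         (ask 6510
                           (ask 65430
                             (ask 65432
                               (ask 654320
                                 (ask 65410 stop (ask 63210 stop (ask 54321 stop stop)))
                                 (ask 43210
                                   (ask 63210
                                     (ask 65410 stop (ask 65210 stop stop))
                                     (ask 54321
                                       (ask 65410 (ask 65210 stop stop) stop)
                                       stop))
                                   (ask 65210
                                     (ask 54321
                                       (ask 63210 (ask 65410 stop stop) stop)
                                       stop)
                                     stop)))
                               (ask 43210
                                 (ask 65410
                                   (ask 54321 (ask 63210 stop (ask 65210 stop stop)) stop)
                                   stop)
                                 stop))
                             (ask 54321
                               (ask 65210
                                 (ask 65410
                                   (ask 65432 (ask 43210 stop (ask 63210 stop stop)) stop)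
                                   stop)
                                 stop)
                               stop))
                           (ask 43210
                             (ask 54321
                               (ask 65432 (ask 65430 (ask 654320 stop stop) stop) stop)
                               stop)
                             stop)))))
                   (ask 43210
                     (ask 54321
                       (ask 543210
                         (ask 654321 stop
                           (ask 643210 stop
                             (ask 63210
                               (ask 650 (ask 65432 stop (ask 6510 stop stop)) stop)
                               stop)))
                         (ask 63210
                           (ask 643210
                             (ask 654321 stop
                               (ask 6510 stop (ask 650 (ask 65432 stop stop) stop)))
                             (ask 650 (ask 65432 (ask 654321 stop stop) stop) stop))
                           stop))
                       stop)
                     stop))
                 (ask 54321
                   (ask 65432
                     (ask 543210
                       (ask 654321 stop (ask 654320 stop (ask 610 (ask 65430 stop stop) stop)))
                       (ask 65430
                         (ask 654320
                           (ask 65410 stop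
                             (ask 6510 stop
                               (ask 654321 stop (ask 43210 (ask 610 stop stop) stop))))
                           (ask 610
                             (ask 654321
                               (ask 43210 stop (ask 65410 stop (ask 6510 stop stop)))
                               stop)
                             stop))
                         stop))
                     stop)
                   stop)))
             (ask 65210
               (ask 65430
                 (ask 653210
                   (ask 654320 stop (ask 65410 stop stop))
                   (ask 65410 (ask 65432 (ask 654320 stop stop) stop) stop))
                 stop)
               stop)))
         (ask 4321
           (ask 43210
             (ask 610
               (ask 6210
                 (ask 63210
                   (ask 543210
                     (ask 643210 stop
                       (ask 653210 stop
                         (ask 650 (ask 6510 (ask 65210 (ask 654 stop stop) stop) stop) stop)))
                     (ask 650
                       (ask 6510
                         (ask 65210
                           (ask 643210
                             (ask 65410 stop
                               (ask 653210 stop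
                                 (ask 6540 stop (ask 54321 (ask 654 stop stop) stop))))
                             (ask 654
                               (ask 653210
                                 (ask 65410 stop (ask 54321 stop (ask 6540 stop stop)))
                                 stop)
                               stop))
                           stop)
                         stop)
                       stop))
                   stop)
                 stop)
               stop)
             stop)
           stop)))
     (ask 6210
       (ask 6510
         (ask 643210
           (ask 654210 stop
             (ask 653210 stop (ask 654310 stop (ask 543 (ask 65210 (ask 65410 stop stop) stop) stop))))
           (ask 65210
             (ask 65410
               (ask 654210
                 (ask 653210 stop
                   (ask 654310 stop
                     (ask 432
                       (ask 543
                         (ask 63210
                           (ask 43210 stop
                             (ask 65430 stop (ask 4321 (ask 6543 stop stop) stop)))
                           stop)
                         stop)
                       stop)))
                 (ask 543
                   (ask 63210
                     (ask 432
                       (ask 654310 stop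
                         (ask 653210
                           (ask 43210 stop
                             (ask 65430 stop (ask 4321 (ask 6543 stop stop) stop)))
                           stop))
                       (ask 653210 (ask 654310 stop stop) stop))
                     stop)
                   stop))
               stop)
             stop))
         stop)
       stop))
   (ask 6540
     (ask 6543
       (ask 654210
         (ask 654320 stop
           (ask 654321 stop (ask 654310 stop (ask 321 (ask 65430 (ask 65432 stop stop) stop) stop))))
         (ask 65430
           (ask 65432
             (ask 654320
               (ask 654310 stop
                 (ask 654321 stop
                   (ask 210
                     (ask 321
                       (ask 65410
                         (ask 65210 stop (ask 54321 stop (ask 4321 (ask 6210 stop stop) stop)))
                         stop)
                       stop)
                     stop)))
               (ask 321
                 (ask 65410
                   (ask 210
                     (ask 654321 stop
                       (ask 654310
                         (ask 54321 stop (ask 65210 stop (ask 4321 (ask 6210 stop stop) stop)))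
                         stop))
                     (ask 654310 (ask 654321 stop stop) stop))
                   stop)
                 stop))
             stop)
           stop))
       stop)
     stop)

-- Assembly for n from 2 to 7

theorem6p14 : (n : ℕ) → 2 ≤ n → n ≤ 7 → (K : Cx n) → IsComplex K →
    MinimalGenerating (Mon n) K →
    (K₂Family K ⊎ K₅Family K) ⊎ (K₆Family K ⊎ K₇Family K)
theorem6p14 2 _ _ K _ = classify cases-2 tree-2 (k₂s-classified k₂s-2) K
theorem6p14 3 _ _ K _ = classify cases-3 tree-3 (k₂s-classified k₂s-3) K
theorem6p14 4 _ _ K _ = classify cases-4 tree-4 (k₂s-classified k₂s-4) K
theorem6p14 5 _ _ K _ = classify cases-5 tree-5
  (AllP.++⁺ (k₂s-classified k₂s-5) (k₅s-classified (ℕₚ.m≤m+n 5 0) k₅s-5)) K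
theorem6p14 6 _ _ K _ = classify cases-6 tree-6
  (AllP.++⁺ (k₂s-classified k₂s-6) (k₅s-classified (ℕₚ.m≤m+n 5 1) k₅s-6)) K
-- At 7 vertices the rotations of K₇ join the candidates; below, there are the K₂ complexes and,
-- from 5 vertices on, the K₅ complexes.
theorem6p14 7 _ _ K _ = classify cases-7 tree-7
  (AllP.++⁺ (k₂s-classified k₂s-7) (AllP.++⁺ (k₅s-classified (ℕₚ.m≤m+n 5 2) k₅s-7) k₇-classified)) K
theorem6p14 0 () _
theorem6p14 1 (s≤s ()) _
theorem6p14 (suc (suc (suc (suc (suc (suc (suc (suc _)))))))) _ (s≤s (s≤s (s≤s (s≤s (s≤s (s≤s (s≤s ())))))))
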